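{- Let $k\ge1$ be the cache size and let $G$ be any access graph containing a path with $k+1$ vertices. If $k$ is odd, then \[\mathcal{I}^{G}[\mathrm{FWF},\mathrm{FIFO}]=\left[0,\ 1-\frac1k\right],\] and if $k$ is even, then \[\left[0,\ \frac{k^2-k-1}{k^2}\right]\subseteq \mathcal{I}^{G}[\mathrm{FWF},\mathrm{FIFO}]\subseteq\left[0,\ \frac{k-1}{k}\right].\]
   Context: Paging: a cache holds at most $k$ pages and is initially empty. A request to a page in the cache is a hit; otherwise it is a fault, the page is brought into the cache, evicting a page first if the cache is full. $\mathcal{A}(I)$ is the number of faults of $\mathcal{A}$ on request sequence $I$. FIFO evicts the cached page that entered the cache earliest. FWF (flush-when-full): on a fault with a full cache, it empties the cache and then brings in the requested page. Access graph: a graph $G$ whose vertices are the pages; a request sequence respects $G$ if any two consecutive requests are identical or adjacent in $G$; $L(G)$ is the set of such sequences. Relative interval: $\mathrm{Min}_{\mathcal{A},\mathcal{B}}(n,G)=\min\{\mathcal{A}(I)-\mathcal{B}(I): I\in L(G),|I|=n\}$, $\mathrm{Max}_{\mathcal{A},\mathcal{B}}(n,G)$ analogously with max; $\mathrm{Min}^G(\mathcal{A},\mathcal{B})=\liminf_{n\to\infty}\mathrm{Min}_{\mathcal{A},\mathcal{B}}(n,G)/n$, $\mathrm{Max}^G(\mathcal{A},\mathcal{B})=\limsup_{n\to\infty}\mathrm{Max}_{\mathcal{A},\mathcal{B}}(n,G)/n$, and $\mathcal{I}^G[\mathcal{A},\mathcal{B}]=[\mathrm{Min}^G(\mathcal{A},\mathcal{B}),\mathrm{Max}^G(\mathcal{A},\mathcal{B})]$.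 -}

module Defs where

open import Data.Bool.Base using (if_then_else_)
open import Data.Fin.Base using (Fin; suc; inject₁)
open import Data.Integer.Base as ℤ using (ℤ; +_)
open import Data.List.Base using (List; []; _∷_; _∷ʳ_; drop; length)
open import Data.List.Relation.Unary.Linked using (Linked)
open import Data.Nat.Base as ℕ using (ℕ; suc; NonZero)
import Data.Nat.Properties as ℕ using (_<?_)
open import Data.Product.Base using (Σ-syntax; ∃-syntax; _×_; _,_)
open import Data.Rational.Base using (ℚ; _<_; _*_; _/_; 1/_; Positive)
open import Data.Rational.Properties
  using (<-dense; <-trans; *-assoc; *-cancelʳ-<-nonNeg; *-identityʳ; *-inverseˡ;
         *-monoˡ-<-pos; normalize-pos; pos⇒nonNeg; pos⇒nonZero)
open import Data.Sum.Base using (_⊎_)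
open import Function.Definitions using (Injective)
open import Level using (0ℓ)
open import Relation.Binary.Core using (Rel)
open import Relation.Binary.Definitions
  using (DecidableEquality; Irreflexive; Symmetric)
open import Relation.Binary.PropositionalEquality.Core
  using (_≡_; sym; trans; cong; subst)
open import Relation.Nullary.Decidable.Core using (does)
open import Relation.Unary using (Pred)
import Data.List.Membership.DecPropositional as DecMembership

-- An extended real x is represented by its lower Dedekind cut
-- { q ∈ ℚ ∣ q < x }.  Classically, the open lower sets of ℚ are exactly
-- the elements of [-∞ , ∞].  Neither inhabitation, boundedness nor
-- locatedness is required, so that suprema and infima always exist.

record ℝ∞ : Set₁ where
  field
    below  : Pred ℚ 0ℓ
    closed : ∀ {p q} → p < q → below q → below p
    open′  : ∀ {p} → below p → ∃[ q ] p < q × below q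

open ℝ∞ public

infix 4 _≤_

_≤_ : ℝ∞ → ℝ∞ → Set
x ≤ y = ∀ {q} → below x q → below y q

ι : ℚ → ℝ∞
ι r .below q      = q < r
ι r .closed p<q q<r = <-trans p<q q<r
ι r .open′ p<r with q , p<q , q<r ← <-dense p<r = q , p<q , q<r

fromℤ : ℤ → ℝ∞
fromℤ z = ι (z / 1)

sup : {A : Set} → (A → ℝ∞) → ℝ∞
sup f .below q = ∃[ a ] below (f a) q
sup f .closed p<q (a , q<fa) = a , closed (f a) p<q q<fa
sup f .open′ (a , p<fa) with q , p<q , q<fa ← open′ (f a) p<fa =
  q , p<q , a , q<fa

-- The intersection of the cuts need not be open, hence the margin r.

inf : {A : Set} → (A → ℝ∞) → ℝ∞
inf f .below q = ∃[ r ] q < r × (∀ a → below (f a) r)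
inf f .closed p<q (r , q<r , r<f) = r , <-trans p<q q<r , r<f
inf f .open′ (r , p<r , r<f) with q , p<q , q<r ← <-dense p<r =
  q , p<q , r , q<r , r<f

sup-attained : {A : Set} (f : A → ℝ∞) (m : A) → (∀ a → f a ≤ f m) →
               sup f ≤ f m × f m ≤ sup f
sup-attained f m f≤fm = (λ (a , q<fa) → f≤fm a q<fa) , (λ q<fm → m , q<fm)

inf-attained : {A : Set} (f : A → ℝ∞) (m : A) → (∀ a → f m ≤ f a) →
               inf f ≤ f m × f m ≤ inf f
inf-attained f m fm≤f =
  (λ (r , q<r , r<f) → closed (f m) q<r (r<f m)) ,
  (λ q<fm → let r , q<r , r<fm = open′ (f m) q<fm in
            r , q<r , λ a → fm≤f a r<fm)

infixl 7 _÷_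

_÷_ : ℝ∞ → (n : ℕ) .{{_ : NonZero n}} → ℝ∞
(x ÷ n) .below q = below x (q * (+ n / 1))
(x ÷ n@(suc _)) .closed p<q =
  closed x (*-monoˡ-<-pos (+ n / 1) {{normalize-pos n 1}} p<q)
(x ÷ n@(suc _)) .open′ {p} pn<x with r , pn<r , r<x ← open′ x pn<x =
  r * 1/ d , *-cancelʳ-<-nonNeg d (subst (p * d <_) (sym eq) pn<r) ,
  subst (below x) (sym eq) r<x
  where
  d = + n / 1
  instance
    d>0 : Positive d
    d>0 = normalize-pos n 1
    d≥0 = pos⇒nonNeg d
    d≢0 = pos⇒nonZero d
  eq : r * 1/ d * d ≡ r
  eq = trans (*-assoc r (1/ d) d)
             (trans (cong (r *_) (*-inverseˡ d)) (*-identityʳ r))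

liminf limsup : (ℕ → ℝ∞) → ℝ∞
liminf x = sup λ N → inf λ ((n , _) : Σ[ n ∈ ℕ ] N ℕ.≤ n) → x n
limsup x = inf λ N → sup λ ((n , _) : Σ[ n ∈ ℕ ] N ℕ.≤ n) → x n

[_,_] : ℝ∞ → ℝ∞ → Pred ℝ∞ 0ℓ
[ x , y ] z = x ≤ z × z ≤ y

-- The vertex set may be infinite.  Decidable equality of pages is what
-- lets a paging algorithm tell hits from faults.

record Graph : Set₁ where
  infix 4 _≟_ _~_
  field
    Vertex   : Set
    _≟_      : DecidableEquality Vertex
    _~_      : Rel Vertex 0ℓ
    ~-sym    : Symmetric _~_
    ~-irrefl : Irreflexive _≡_ _~_

module _ (G : Graph) where
  open Graph G

  -- A path with suc l vertices, as a subgraph (not necessarily induced).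

  record Path (l : ℕ) : Set where
    field
      vertex   : Fin (suc l) → Vertex
      distinct : Injective _≡_ _≡_ vertex
      adjacent : ∀ (i : Fin l) → vertex (inject₁ i) ~ vertex (suc i)

  Respects : Pred (List Vertex) 0ℓ
  Respects = Linked (λ u v → u ≡ v ⊎ u ~ v)

  Requests : ℕ → Set
  Requests n = Σ[ I ∈ List Vertex ] Respects I × length I ≡ n

  -- The cache lists its pages in order of entry, oldest first.  An
  -- eviction rule says what remains of a full cache before the faulting
  -- page is brought in.

  Cache : Set
  Cache = List Vertex

  module _ (k : ℕ) (evict : Cache → Cache) where
    open DecMembership _≟_ using (_∈?_)

    bringIn : Vertex → Cache → Cache
    bringIn p c = (if does (length c ℕ.<? k) then c else evict c) ∷ʳ p

    faultsFrom : Cache → List Vertex → ℕ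
    faultsFrom c []      = 0
    faultsFrom c (p ∷ I) =
      if does (p ∈? c) then faultsFrom c I
                       else suc (faultsFrom (bringIn p c) I)

    faults : List Vertex → ℕ
    faults = faultsFrom []

  FIFO FWF : ℕ → List Vertex → ℕ
  FIFO k = faults k (drop 1)
  FWF  k = faults k (λ _ → [])

  -- An algorithm enters only through its number of faults.

  module _ (A B : List Vertex → ℕ) where

    diff : ∀ {n} → Requests n → ℝ∞
    diff (I , _) = fromℤ (+ A I ℤ.- + B I)

    -- The differences are integers in [-n , n], so for inhabited
    -- Requests n the infimum and the supremum are attained classically; see
    -- inf-attained and sup-attained.

    Min Max : ℕ → ℝ∞
    Min n = inf (diff {n})
    Max n = sup (diff {n})

    -- Sequences start at length 1, where the quotient is defined.

    relativeInterval : Pred ℝ∞ 0ℓ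
    relativeInterval = [ liminf (λ n → Min (suc n) ÷ suc n)
                       , limsup (λ n → Max (suc n) ÷ suc n) ]

-- FWF faults at most k times per phase, and exactly k times in a complete one,
-- while FIFO faults at most k times on any stretch with at most k distinct
-- pages and at least once between the second request of a phase and the first
-- of the next.  Hence 0 ≤ FWF - FIFO ≤ (1 - 1 / k) n + O(1) on n requests.
--
-- For the lower bound, walk to and fro along the path 0 , … , k: FWF faults on
-- every request.  FIFO always misses one of the k + 1 pages, and the pages it
-- faults on recur cyclically in the order of their first visits.  Start in the
-- middle and spiral outwards, so that this order alternates between the two
-- halves of the path: h , h - 1 , h + 1 , h - 2 , … , k , 0 if k is odd, where
-- each sweep of k requests up or down the path then contains one fault.  For
-- even k the order h , h + 1 , h - 1 , h + 2 , … , k , 0 has odd length and,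
-- read cyclically, the two consecutive ascents 0 , h , h + 1, so one sweep in k
-- has two faults: k + 1 faults in k ^ 2 requests.

module Submission where

open import Defs renaming (_≤_ to _≤∞_)
open import Data.Fin.Base using (toℕ; fromℕ<)
import Data.Fin.Properties as Fin
open import Data.Integer.Base as ℤ using (ℤ; +_; -[1+_])
import Data.Integer.Properties as ℤ
import Data.Integer.Tactic.RingSolver as ℤ-Solver
open import Data.List.Base as List using (List; []; _∷_; _++_; _∷ʳ_; drop; length; map)
import Data.List.Membership.DecPropositional as DecMembership
open import Data.List.Membership.Propositional using (_∈_; _∉_)
open import Data.List.Membership.Propositional.Properties
  using (∈-∃++; ∈-++⁺ˡ; ∈-++⁺ʳ; ∈-++⁻; ∈-map⁺; ∈-map⁻)
open import Data.List.Properties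
  using (++-assoc; ++-identityʳ; length-++; length-++-comm; length-map; map-++; ∷-injective)
open import Data.List.Relation.Binary.Permutation.Propositional
  using (_↭_; ↭-refl; ↭-sym; ↭-trans; ↭-reflexive; ↭⇒↭ₛ; prep)
open import Data.List.Relation.Binary.Permutation.Propositional.Properties
  using (∈-resp-↭; ↭-length; ∷↭∷ʳ; ++⁺ʳ)
import Data.List.Relation.Binary.Permutation.Setoid.Properties as ↭ₛ
import Data.List.Relation.Binary.Subset.Propositional as Subset
open import Data.List.Relation.Unary.All as All using (All; []; _∷_)
open import Data.List.Relation.Unary.All.Properties using (All¬⇒¬Any)
open import Data.List.Relation.Unary.AllPairs as AllPairs using (AllPairs; []; _∷_)
open import Data.List.Relation.Unary.Any using (here; there)
open import Data.List.Relation.Unary.Linked as Linked using ([-]; _∷_)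
open import Data.List.Relation.Unary.Unique.Propositional using (Unique)
open import Data.List.Relation.Unary.Unique.Propositional.Properties using (++⁺)
open import Data.Nat.Base
  using (ℕ; zero; suc; _+_; _*_; _⊓_; _^_; _≤_; _<_; _>_; _≮_; z≤n; s≤s; s≤s⁻¹; NonZero; ≢-nonZero⁻¹)
open import Data.Nat.Divisibility using (_∣_; _∤_; divides)
open import Data.Nat.Properties hiding (_≟_)
import Data.Nat.Tactic.RingSolver as ℕ-Solver
open import Data.Product.Base using (Σ-syntax; ∃-syntax; _×_; _,_; proj₁; proj₂)
open import Data.Rational.Base as ℚ using (0ℚ; 1ℚ; ↥_; ↧_; ↧ₙ_; toℚᵘ; _/_; _-_)
import Data.Rational.Properties as ℚ
open import Data.Rational.Unnormalised.Base as ℚᵘ using (mkℚᵘ)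
import Data.Rational.Unnormalised.Properties as ℚᵘ
open import Data.Sum.Base using (_⊎_; inj₁; inj₂)
open import Function.Base using (_∘_)
open import Level using (0ℓ)
open import Relation.Binary.Core using (Rel)
open import Relation.Binary.Definitions using (Asymmetric)
open import Relation.Binary.PropositionalEquality hiding ([_])
open import Relation.Nullary using (¬_; yes; no; contradiction)
open import Relation.Nullary.Decidable using (dec-true; dec-false)
open import Relation.Unary using (_≐_; _⊆_)

-- Lists with one element appended, and the pigeonhole principle.

module _ {A : Set} where

  ⊆-∷ʳ : ∀ {xs ys : List A} {p} → xs Subset.⊆ ys → p ∈ ys → (xs ∷ʳ p) Subset.⊆ ys
  ⊆-∷ʳ {xs} xs⊆ys p∈ys q∈ with ∈-++⁻ xs q∈
  ... | inj₁ q∈xs        = xs⊆ys q∈xs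
  ... | inj₂ (here refl) = p∈ys

  length-∷ʳ : ∀ (xs : List A) p → length (xs ∷ʳ p) ≡ suc (length xs)
  length-∷ʳ xs p = length-++-comm xs List.[ p ]

  +-length-∷ʳ : ∀ n (xs : List A) p → n + length (xs ∷ʳ p) ≡ suc (n + length xs)
  +-length-∷ʳ n xs p = trans (cong (_+_ n) (length-∷ʳ xs p)) (+-suc n _)

  Unique-∷ʳ : ∀ {xs : List A} {p} → Unique xs → p ∉ xs → Unique (xs ∷ʳ p)
  Unique-∷ʳ u p∉xs = ++⁺ u ([] ∷ []) λ { (q∈xs , here refl) → p∉xs q∈xs }

  Unique-⊆⇒length-≤ : ∀ {xs ys : List A} → Unique xs → xs Subset.⊆ ys → length xs ≤ length ys
  Unique-⊆⇒length-≤ [] _ = z≤n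
  Unique-⊆⇒length-≤ {x ∷ xs} (x∉ ∷ u) xs⊆ys with as , bs , refl ← ∈-∃++ (xs⊆ys (here refl)) =
    ≤-trans (s≤s (Unique-⊆⇒length-≤ u xs⊆)) (≤-reflexive eq)
    where
    xs⊆ : xs Subset.⊆ (as ++ bs)
    xs⊆ q∈ with ∈-++⁻ as (xs⊆ys (there q∈))
    ... | inj₁ q∈as         = ∈-++⁺ˡ q∈as
    ... | inj₂ (here refl)  = contradiction q∈ (All¬⇒¬Any x∉)
    ... | inj₂ (there q∈bs) = ∈-++⁺ʳ as q∈bs
    eq : suc (length (as ++ bs)) ≡ length (as ++ x ∷ bs)
    eq = trans (cong suc (length-++ as)) (trans (sym (+-suc _ _)) (sym (length-++ as)))

-- FIFO against FWF on arbitrary request sequences.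

module _ (G : Graph) (k : ℕ) where
  open Graph G
  open DecMembership _≟_ using (_∈?_)

  module _ (evict : Cache G → Cache G) where

    faultsFrom-hit : ∀ {c p} I → p ∈ c →
                     faultsFrom G k evict c (p ∷ I) ≡ faultsFrom G k evict c I
    faultsFrom-hit {c} {p} I p∈c rewrite dec-true (p ∈? c) p∈c = refl

    faultsFrom-miss : ∀ {c p} I → p ∉ c →
                      faultsFrom G k evict c (p ∷ I) ≡ suc (faultsFrom G k evict (bringIn G k evict p c) I)
    faultsFrom-miss {c} {p} I p∉c rewrite dec-false (p ∈? c) p∉c = refl

    bringIn-room : ∀ {c} p → length c < k → bringIn G k evict p c ≡ c ∷ʳ p
    bringIn-room {c} p c<k rewrite dec-true (length c <? k) c<k = refl

    bringIn-full : ∀ {c} p → length c ≮ k → bringIn G k evict p c ≡ evict c ∷ʳ p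
    bringIn-full {c} p c≮k rewrite dec-false (length c <? k) c≮k = refl

    ∈-bringIn : ∀ {c} p → p ∈ bringIn G k evict p c
    ∈-bringIn p = ∈-++⁺ʳ _ (here refl)

    faultsFrom≤length : ∀ c I → faultsFrom G k evict c I ≤ length I
    faultsFrom≤length c [] = z≤n
    faultsFrom≤length c (p ∷ I) with p ∈? c
    ... | yes p∈ = m≤n⇒m≤1+n (faultsFrom≤length c I)
    ... | no p∉ = s≤s (faultsFrom≤length _ I)

  fifo fwf : Cache G → List Vertex → ℕ
  fifo = faultsFrom G k (drop 1)
  fwf  = faultsFrom G k (λ _ → [])

  -- A full cache is longer than `S`, so its oldest page, the one evicted, lies in `R`.
  FIFO-bringIn-suffix : ∀ {c} p R S → c ≡ R ++ S → length S < k →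
                        ∃[ R′ ] bringIn G k (drop 1) p c ≡ R′ ++ (S ∷ʳ p)
  FIFO-bringIn-suffix p R S refl S<k with length (R ++ S) <? k
  ... | yes c<k rewrite bringIn-room (drop 1) {R ++ S} p c<k = R , ++-assoc R S List.[ p ]
  ... | no c≮k rewrite bringIn-full (drop 1) {R ++ S} p c≮k with R
  ...   | []     = contradiction S<k c≮k
  ...   | _ ∷ R′ = R′ , ++-assoc R′ S List.[ p ]

  FIFO-bringIn-length : ∀ {c} p → 0 < k → length c ≤ k → length (bringIn G k (drop 1) p c) ≤ k
  FIFO-bringIn-length {c} p 0<k c≤k with length c <? k
  ... | yes c<k rewrite bringIn-room (drop 1) {c} p c<k | length-∷ʳ c p = c<k
  ... | no c≮k rewrite bringIn-full (drop 1) {c} p c≮k with c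
  ...   | []     = 0<k
  ...   | _ ∷ c′ rewrite length-∷ʳ c′ p = c≤k

  -- R ++ S is the FIFO cache and D the FWF cache, whose pages are those
  -- requested in the current phase.  FIFO's faults of this phase brought in
  -- the pages of S, and fewer than k later faults cannot evict any of them.
  fifo≤fwf : ∀ I {c D} R S → c ≡ R ++ S → S Subset.⊆ D → Unique S → length D ≤ k → 0 < k →
             fifo c I + length S ≤ fwf D I + length D
  fifo≤fwf [] R S c≡ S⊆D uS D≤k 0<k = Unique-⊆⇒length-≤ uS S⊆D
  fifo≤fwf (p ∷ I) {c} {D} R S c≡ S⊆D uS D≤k 0<k with p ∈? c | p ∈? D
  ... | yes p∈c | yes p∈D =
    fifo≤fwf I R S c≡ S⊆D uS D≤k 0<k
  ... | no p∉c | yes p∈D =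
    let R′ , eq = FIFO-bringIn-suffix p R S c≡ |S|<k in
    subst (_≤ fwf D I + length D) (+-length-∷ʳ _ S p)
      (fifo≤fwf I R′ (S ∷ʳ p) eq S+p⊆D uS+p D≤k 0<k)
    where
    p∉S : p ∉ S
    p∉S p∈S = p∉c (subst (p ∈_) (sym c≡) (∈-++⁺ʳ R p∈S))
    uS+p = Unique-∷ʳ uS p∉S
    S+p⊆D = ⊆-∷ʳ S⊆D p∈D
    |S|<k : length S < k
    |S|<k = subst (_≤ k) (length-∷ʳ S p) (≤-trans (Unique-⊆⇒length-≤ uS+p S+p⊆D) D≤k)
  ... | p∈?c | no p∉D with length D <? k
  fifo≤fwf (p ∷ I) {c} {D} R S c≡ S⊆D uS D≤k 0<k
      | yes p∈c | no p∉D | yes D<k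
    rewrite bringIn-room (λ _ → []) {D} p D<k =
    subst (fifo c I + length S ≤_) (+-length-∷ʳ _ D p)
      (fifo≤fwf I {D = D ∷ʳ p} R S c≡ (∈-++⁺ˡ ∘ S⊆D) uS (subst (_≤ k) (sym (length-∷ʳ D p)) D<k) 0<k)
  fifo≤fwf (p ∷ I) {c} {D} R S c≡ S⊆D uS D≤k 0<k
      | no p∉c | no p∉D | yes D<k
    rewrite bringIn-room (λ _ → []) {D} p D<k =
    let R′ , eq = FIFO-bringIn-suffix p R S c≡ (≤-<-trans (Unique-⊆⇒length-≤ uS S⊆D) D<k) in
    subst₂ _≤_ (+-length-∷ʳ _ S p)
               (+-length-∷ʳ _ D p)
      (fifo≤fwf I {D = D ∷ʳ p} R′ (S ∷ʳ p) eq (⊆-∷ʳ (∈-++⁺ˡ ∘ S⊆D) (∈-++⁺ʳ D (here refl))) (Unique-∷ʳ uS p∉S)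
                (subst (_≤ k) (sym (length-∷ʳ D p)) D<k) 0<k)
    where
    p∉S : p ∉ S
    p∉S p∈S = p∉c (subst (p ∈_) (sym c≡) (∈-++⁺ʳ R p∈S))
  fifo≤fwf (p ∷ I) {c} {D} R S c≡ S⊆D uS D≤k 0<k
      | yes p∈c | no p∉D | no D≮k
    rewrite bringIn-full (λ _ → []) {D} p D≮k =
    -- The flush starts a phase in which FIFO has not yet faulted: `S` becomes empty and all of `c`
    -- becomes `R`. The finished phase is settled by `length S ≤ length D`.
    +-mono-≤ (subst₂ _≤_ (+-identityʳ _) (+-comm _ 1)
               (fifo≤fwf I {c} {List.[ p ]} c [] (sym (++-identityʳ c)) (λ ()) [] 0<k 0<k))
             (Unique-⊆⇒length-≤ uS S⊆D)
  fifo≤fwf (p ∷ I) {c} {D} R S c≡ S⊆D uS D≤k 0<k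
      | no p∉c | no p∉D | no D≮k
    rewrite bringIn-full (λ _ → []) {D} p D≮k =
    let R′ , eq = FIFO-bringIn-suffix p c [] (sym (++-identityʳ c)) 0<k in
    +-mono-≤ (subst₂ _≤_ (+-comm _ 1) (+-comm _ 1)
               (fifo≤fwf I {bringIn G k (drop 1) p c} {List.[ p ]} R′ List.[ p ] eq (λ q∈ → q∈) ([] ∷ []) 0<k 0<k))
             (Unique-⊆⇒length-≤ uS S⊆D)

  FIFO≤FWF : 0 < k → ∀ I → FIFO G k I ≤ FWF G k I
  FIFO≤FWF 0<k I = subst₂ _≤_ (+-identityʳ _) (+-identityʳ _)
    (fifo≤fwf I [] [] refl (λ ()) [] z≤n 0<k)

  -- A phase is k distinct pages, and a new one starts the next phase; after
  -- the first page of the phase FIFO has it in the cache too, so FIFO faults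
  -- on one of the other k pages.  D is the FWF cache and c the FIFO cache: as
  -- long as D ⊆ c, that fault may be still to come.
  mutual
    fwf≤k*fifo : ∀ I {c D} → 0 < k → length c ≤ k → Unique D → D Subset.⊆ c →
                 fwf D I + length D ≤ k * fifo c I + k
    fwf≤k*fifo [] 0<k c≤k uD D⊆c rewrite *-zeroʳ k = ≤-trans (Unique-⊆⇒length-≤ uD D⊆c) c≤k
    fwf≤k*fifo (p ∷ I) {c} {D} 0<k c≤k uD D⊆c with p ∈? c | p ∈? D
    ... | yes p∈c | yes p∈D =
      fwf≤k*fifo I 0<k c≤k uD D⊆c
    ... | no p∉c | yes p∈D = contradiction (D⊆c p∈D) p∉c
    ... | yes p∈c | no p∉D
      rewrite bringIn-room (λ _ → []) {D} p (≤-trans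
                (subst (_≤ length c) (length-∷ʳ D p)
                  (Unique-⊆⇒length-≤ (Unique-∷ʳ uD p∉D) (⊆-∷ʳ D⊆c p∈c)))
                c≤k) =
      subst (_≤ k * fifo c I + k) (+-length-∷ʳ _ D p)
        (fwf≤k*fifo I {D = D ∷ʳ p} 0<k c≤k (Unique-∷ʳ uD p∉D) (⊆-∷ʳ D⊆c p∈c))
    ... | no p∉c | no p∉D =
      -- FIFO's fault adds `k` to the right-hand side, which pays for the larger constant `k + k` of
      -- the state in which `D` may have left `c`.
      ≤-trans
        (fwf-miss≤k*fifo+k I 0<k (FIFO-bringIn-length p 0<k c≤k)
          (≤-trans (Unique-⊆⇒length-≤ uD D⊆c) c≤k) (∈-bringIn (drop 1) {c} p))
        (≤-reflexive eq)
      where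
      f = fifo (bringIn G k (drop 1) p c) I
      eq : k * f + (k + k) ≡ k * suc f + k
      eq = trans (sym (+-assoc (k * f) k k))
             (cong (_+ k) (trans (+-comm (k * f) k) (sym (*-suc k f))))

    -- Here a fault of FIFO has already been counted for the current phase. The additional `k`
    -- covers the pages of `D` when the next phase begins; further faults of FIFO until then are
    -- given away.
    fwf≤k*fifo+k : ∀ I {c D} → 0 < k → length c ≤ k → length D ≤ k →
                   fwf D I + length D ≤ k * fifo c I + (k + k)
    fwf≤k*fifo+k [] 0<k c≤k D≤k rewrite *-zeroʳ k = ≤-trans D≤k (m≤m+n k k)
    fwf≤k*fifo+k (p ∷ I) {c} {D} 0<k c≤k D≤k with p ∈? c | p ∈? D
    ... | yes p∈c | yes p∈D =
      fwf≤k*fifo+k I 0<k c≤k D≤k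
    ... | yes p∈c | no p∉D = fwf-miss≤k*fifo+k I 0<k c≤k D≤k p∈c
    ... | no p∉c | yes p∈D =
      ≤-trans (fwf≤k*fifo+k I 0<k (FIFO-bringIn-length p 0<k c≤k) D≤k)
              (+-monoˡ-≤ (k + k) (*-monoʳ-≤ k (n≤1+n _)))
    ... | no p∉c | no p∉D =
      ≤-trans (fwf-miss≤k*fifo+k I 0<k (FIFO-bringIn-length p 0<k c≤k) D≤k (∈-bringIn (drop 1) {c} p))
              (+-monoˡ-≤ (k + k) (*-monoʳ-≤ k (n≤1+n _)))

    -- Whether FIFO hits or faults on `p`, its cache `c` afterwards contains `p`, so one argument
    -- serves both.
    fwf-miss≤k*fifo+k : ∀ I {c D p} → 0 < k → length c ≤ k → length D ≤ k → p ∈ c →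
                        suc (fwf (bringIn G k (λ _ → []) p D) I) + length D ≤ k * fifo c I + (k + k)
    fwf-miss≤k*fifo+k I {c} {D} {p} 0<k c≤k D≤k p∈c with length D <? k
    ... | yes D<k rewrite bringIn-room (λ _ → []) {D} p D<k =
      subst (_≤ k * fifo c I + (k + k)) (+-length-∷ʳ _ D p)
        (fwf≤k*fifo+k I {D = D ∷ʳ p} 0<k c≤k (subst (_≤ k) (sym (length-∷ʳ D p)) D<k))
    ... | no D≮k rewrite bringIn-full (λ _ → []) {D} p D≮k =
      -- The bound `length D ≤ k` for the finished phase uses up the second `k`; the new phase
      -- starts with `p` alone, inside `c` again.
      ≤-trans (+-mono-≤ (subst (_≤ k * fifo c I + k) (+-comm _ 1)
                          (fwf≤k*fifo I {c} {List.[ p ]} 0<k c≤k ([] ∷ []) (λ { (here refl) → p∈c }))) D≤k)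
              (≤-reflexive (+-assoc (k * fifo c I) k k))

  FWF≤k*FIFO+k : 0 < k → ∀ I → FWF G k I ≤ k * FIFO G k I + k
  FWF≤k*FIFO+k 0<k I = subst (_≤ k * FIFO G k I + k) (+-identityʳ _)
    (fwf≤k*fifo I 0<k z≤n [] (λ ()))

-- Sweeps, the spiral and the order of its first visits.

upFrom downTo : ℕ → ℕ → List ℕ
upFrom s zero    = []
upFrom s (suc n) = s ∷ upFrom (suc s) n
downTo s zero    = []
downTo s (suc n) = s + n ∷ downTo s n

upFrom-∷ʳ : ∀ s n → upFrom s n ∷ʳ (s + n) ≡ upFrom s (suc n)
upFrom-∷ʳ s zero    = cong List.[_] (+-identityʳ s)
upFrom-∷ʳ s (suc n) rewrite +-suc s n = cong (s ∷_) (upFrom-∷ʳ (suc s) n)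

downTo-∷ʳ : ∀ s n → downTo (suc s) n ∷ʳ s ≡ downTo s (suc n)
downTo-∷ʳ s zero    = cong List.[_] (sym (+-identityʳ s))
downTo-∷ʳ s (suc n) = cong₂ _∷_ (sym (+-suc s n)) (downTo-∷ʳ s n)

downTo↭upFrom : ∀ s n → downTo s n ↭ upFrom s n
downTo↭upFrom s zero    = ↭-refl
downTo↭upFrom s (suc n) = ↭-trans (prep (s + n) (downTo↭upFrom s n))
  (↭-trans (∷↭∷ʳ (s + n) (upFrom s n)) (↭-reflexive (upFrom-∷ʳ s n)))

length-upFrom : ∀ s n → length (upFrom s n) ≡ n
length-upFrom s zero    = refl
length-upFrom s (suc n) = cong suc (length-upFrom (suc s) n)

∈-upFrom⁺ : ∀ {s n x} → s ≤ x → x < s + n → x ∈ upFrom s n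
∈-upFrom⁺ {s} {zero}  s≤x x<s = contradiction (<-≤-trans x<s (≤-trans (≤-reflexive (+-identityʳ s)) s≤x)) (<-irrefl refl)
∈-upFrom⁺ {s} {suc n} {x} s≤x x<s+n with m≤n⇒m<n∨m≡n s≤x
... | inj₁ s<x  = there (∈-upFrom⁺ s<x (subst (x <_) (+-suc s n) x<s+n))
... | inj₂ refl = here refl

∈-upFrom⁻ : ∀ {s n x} → x ∈ upFrom s n → s ≤ x × x < s + n
∈-upFrom⁻ {s} {suc n} (here refl) = ≤-refl , m<m+n s (s≤s z≤n)
∈-upFrom⁻ {s} {suc n} {x} (there x∈) with s<x , x< ← ∈-upFrom⁻ {suc s} x∈ =
  <⇒≤ s<x , subst (x <_) (sym (+-suc s n)) x<

∈-downTo⁺ : ∀ {s n x} → s ≤ x → x < s + n → x ∈ downTo s n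
∈-downTo⁺ {s} {n} s≤x x< = ∈-resp-↭ (↭-sym (downTo↭upFrom s n)) (∈-upFrom⁺ s≤x x<)

∈-downTo⁻ : ∀ {s n x} → x ∈ downTo s n → s ≤ x × x < s + n
∈-downTo⁻ {s} {n} x∈ = ∈-upFrom⁻ (∈-resp-↭ (downTo↭upFrom s n) x∈)

upFrom-increasing : ∀ s n → AllPairs _<_ (upFrom s n)
upFrom-increasing s zero    = []
upFrom-increasing s (suc n) = All.tabulate (proj₁ ∘ ∈-upFrom⁻) ∷ upFrom-increasing (suc s) n

downTo-decreasing : ∀ s n → AllPairs _>_ (downTo s n)
downTo-decreasing s zero    = []
downTo-decreasing s (suc n) = All.tabulate (proj₂ ∘ ∈-downTo⁻) ∷ downTo-decreasing s n

infix 8 _^^_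

_^^_ : {A : Set} → List A → ℕ → List A
xs ^^ zero  = []
xs ^^ suc n = xs ++ xs ^^ n

-- For `alternate l h` this is `h , l - 1 , h + 1 , l - 2 , … , h + l - 1 , 0`: the order of the
-- first visits still to come when the spiral has visited exactly the pages from `l` to `h - 1`.
alternate : (lows hi : ℕ) → List ℕ
alternate zero    h = []
alternate (suc l) h = h ∷ l ∷ alternate l (suc h)

-- In `spiral l d` the `d` pages from `l` on have been visited. A round climbs to the next page
-- above them and descends to the next one below. It begins by repeating the page requested last,
-- except that for `d` equal to 0 this request is itself the first visit above.
spiral : (lows visited : ℕ) → List ℕ
spiral zero    d = []
spiral (suc l) d = upFrom (suc l) (suc d) ++ downTo l (suc d) ++ spiral l (suc (suc d))

-- Walks on the positions 0 to `k` of the path.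

module Zigzag (k-1 : ℕ) where

  private
    k = suc k-1

  Step : Rel ℕ _
  Step i j = i ≤ k × j ≤ k × (i ≡ j ⊎ suc i ≡ j ⊎ i ≡ suc j)

  data Walk : ℕ → List ℕ → ℕ → Set where
    []  : ∀ {i} → Walk i [] i
    _∷_ : ∀ {i j I l} → Step i j → Walk j I l → Walk i (j ∷ I) l

  infixr 5 _++ʷ_
  _++ʷ_ : ∀ {i I j J l} → Walk i I j → Walk j J l → Walk i (I ++ J) l
  []      ++ʷ w′ = w′
  (s ∷ w) ++ʷ w′ = s ∷ (w ++ʷ w′)

  walk-^^ : ∀ {i I} n → Walk i I i → Walk i (I ^^ n) i
  walk-^^ zero    w = []
  walk-^^ (suc n) w = w ++ʷ walk-^^ n w

  walk-upFrom : ∀ s n → s + n ≤ k → Walk s (upFrom (suc s) n) (s + n)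
  walk-upFrom s zero    s+n≤k = subst (Walk s []) (sym (+-identityʳ s)) []
  walk-upFrom s (suc n) s+n≤k = subst (Walk s _) (sym (+-suc s n))
    ((≤-trans (m≤m+n s (suc n)) s+n≤k , ≤-trans (m≤m+n (suc s) n) s+n≤k′ , inj₂ (inj₁ refl))
      ∷ walk-upFrom (suc s) n s+n≤k′)
    where s+n≤k′ = subst (_≤ k) (+-suc s n) s+n≤k

  walk-downTo : ∀ s n → s + n ≤ k → Walk (s + n) (downTo s n) s
  walk-downTo s zero    s+n≤k = subst (λ i → Walk i [] s) (sym (+-identityʳ s)) []
  walk-downTo s (suc n) s+n≤k =
    (s+n≤k , s+n≤k′ , inj₂ (inj₂ (+-suc s n))) ∷ walk-downTo s n s+n≤k′
    where s+n≤k′ = ≤-trans (+-monoʳ-≤ s (n≤1+n n)) s+n≤k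

  -- With `h` the top `suc l + d` of a round, `l + h` is the same in all rounds; its value `k` keeps
  -- the walk on the path and makes the last round turn at `k` and end at 0.
  walk-spiral : ∀ l d → l + (suc l + d) ≡ k → Walk (suc l) (spiral (suc l) d) 0
  walk-spiral l d eq =
    ((1+l≤k , 1+l≤k , inj₁ refl) ∷ walk-upFrom (suc l) d 1+l+d≤k)
      ++ʷ (subst (λ i → Walk i (downTo l (suc d)) l) (+-suc l d)
            (walk-downTo l (suc d) (subst (_≤ k) (sym (+-suc l d)) 1+l+d≤k)))
      ++ʷ rest l eq
    where
    1+l+d≤k : suc l + d ≤ k
    1+l+d≤k = subst (suc l + d ≤_) eq (m≤n+m _ l)
    1+l≤k = ≤-trans (m≤m+n (suc l) d) 1+l+d≤k
    rest : ∀ l → l + (suc l + d) ≡ k → Walk l (spiral l (suc (suc d))) 0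
    rest zero     _  = []
    rest (suc l′) eq = walk-spiral l′ (suc (suc d)) (trans (shift l′ d) eq)
      where
      shift : ∀ l d → l + (suc l + suc (suc d)) ≡ suc l + (suc (suc l) + d)
      shift = ℕ-Solver.solve-∀

  zigzag : List ℕ
  zigzag = upFrom 1 k ++ downTo 0 k

  walk-zigzag : Walk 0 zigzag 0
  walk-zigzag = walk-upFrom 0 k ≤-refl ++ʷ walk-downTo 0 k ≤-refl

  Order : List ℕ → Set
  Order ℓ = ℓ ↭ upFrom 0 (suc k)

  module _ {ℓ : List ℕ} (o : Order ℓ) where

    Order-bounded : All (_≤ k) ℓ
    Order-bounded = All.tabulate (s≤s⁻¹ ∘ proj₂ ∘ ∈-upFrom⁻ ∘ ∈-resp-↭ o)

    Order-complete : ∀ {i} → i ≤ k → i ∈ ℓ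
    Order-complete i≤k = ∈-resp-↭ (↭-sym o) (∈-upFrom⁺ z≤n (s≤s i≤k))

    Order-unique : Unique ℓ
    Order-unique = ↭ₛ.Unique-resp-↭ (setoid ℕ) (↭⇒↭ₛ (↭-sym o))
      (AllPairs.map <⇒≢ (upFrom-increasing 0 (suc k)))

    Order-length : length ℓ ≡ suc k
    Order-length = trans (↭-length o) (length-upFrom 0 (suc k))

  Order-rotate : ∀ {m t} → Order (m ∷ t) → Order (t ∷ʳ m)
  Order-rotate {m} {t} o = ↭-trans (↭-sym (∷↭∷ʳ m t)) o

  -- Counting faults on the pages of the path.

  module PathPages (G : Graph) (v : ℕ → Graph.Vertex G)
                   (v-injective : ∀ {i j} → i ≤ k → j ≤ k → v i ≡ v j → i ≡ j) where

    v∉ : ∀ {i t} → i ≤ k → All (_≤ k) t → i ∉ t → v i ∉ map v t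
    v∉ i≤k t≤k i∉t vi∈ with j , j∈t , eq ← ∈-map⁻ v vi∈ =
      i∉t (subst (_∈ _) (sym (v-injective i≤k (All.lookup t≤k j∈t) eq)) j∈t)

    module Runs (evict : Cache G → Cache G) (evictℕ : List ℕ → List ℕ)
                (evict-map : ∀ t → evict (map v t) ≡ map v (evictℕ t)) where

      -- `faultsFrom` returns no cache, so reaching `t′` is expressed through the faults on every
      -- continuation `J`; this is what lets runs be concatenated. With `evict` abstract, one
      -- analysis of the spiral serves both algorithms.
      record Run (t I : List ℕ) (n : ℕ) (t′ : List ℕ) : Set where
        constructor ⟨_⟩
        field
          faultsFrom-run : ∀ J → faultsFrom G k evict (map v t) (map v I ++ J)
                               ≡ n + faultsFrom G k evict (map v t′) J

      open Run public

      run-[] : ∀ {t} → Run t [] 0 t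
      run-[] = ⟨ (λ J → refl) ⟩

      run-++ : ∀ {t t′ t″ I I′ n n′} → Run t I n t′ → Run t′ I′ n′ t″ → Run t (I ++ I′) (n + n′) t″
      run-++ {t} {t′} {t″} {I} {I′} {n} {n′} ⟨ r ⟩ ⟨ r′ ⟩ = ⟨ (λ J → begin
        f t (map v (I ++ I′) ++ J)         ≡⟨ cong (λ K → f t (K ++ J)) (map-++ v I I′) ⟩
        f t ((map v I ++ map v I′) ++ J)   ≡⟨ cong (f t) (++-assoc (map v I) (map v I′) J) ⟩
        f t (map v I ++ (map v I′ ++ J))   ≡⟨ r (map v I′ ++ J) ⟩
        n + f t′ (map v I′ ++ J)           ≡⟨ cong (_+_ n) (r′ J) ⟩
        n + (n′ + f t″ J)                  ≡⟨ +-assoc n n′ (f t″ J) ⟨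
        n + n′ + f t″ J                    ∎) ⟩
        where
        open ≡-Reasoning
        f : List ℕ → List (Graph.Vertex G) → ℕ
        f t = faultsFrom G k evict (map v t)

      run-^^ : ∀ {t I n} m → Run t I n t → Run t (I ^^ m) (m * n) t
      run-^^ zero    r = run-[]
      run-^^ (suc m) r = run-++ r (run-^^ m r)

      run-hit : ∀ {i t I n t′} → i ∈ t → Run t I n t′ → Run t (i ∷ I) n t′
      run-hit {I = I} i∈t ⟨ r ⟩ = ⟨ (λ J →
        trans (faultsFrom-hit G k evict (map v I ++ J) (∈-map⁺ v i∈t)) (r J)) ⟩

      run-hits : ∀ {t I} → All (_∈ t) I → Run t I 0 t
      run-hits []         = run-[]
      run-hits (i∈t ∷ I⊆t) = run-hit i∈t (run-hits I⊆t)

      run-room : ∀ {i t I n t′} → i ≤ k → All (_≤ k) t → i ∉ t → length t < k →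
                 Run (t ∷ʳ i) I n t′ → Run t (i ∷ I) (suc n) t′
      run-room {i} {t} {I} i≤k t≤k i∉t t<k ⟨ r ⟩ = ⟨ (λ J →
        trans (faultsFrom-miss G k evict (map v I ++ J) (v∉ i≤k t≤k i∉t))
          (cong suc (trans (cong (λ c → faultsFrom G k evict c (map v I ++ J))
            (trans (bringIn-room G k evict (v i) (subst (_< k) (sym (length-map v t)) t<k))
                   (sym (map-++ v t List.[ i ]))))
            (r J)))) ⟩

      run-full : ∀ {i t I n t′} → i ≤ k → All (_≤ k) t → i ∉ t → length t ≡ k →
                 Run (evictℕ t ∷ʳ i) I n t′ → Run t (i ∷ I) (suc n) t′
      run-full {i} {t} {I} i≤k t≤k i∉t t≡k ⟨ r ⟩ = ⟨ (λ J →
        trans (faultsFrom-miss G k evict (map v I ++ J) (v∉ i≤k t≤k i∉t))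
          (cong suc (trans (cong (λ c → faultsFrom G k evict c (map v I ++ J))
            (trans (bringIn-full G k evict (v i) (<-irrefl (trans (length-map v t) t≡k)))
            (trans (cong (_∷ʳ v i) (evict-map t)) (sym (map-++ v (evictℕ t) List.[ i ])))))
            (r J)))) ⟩

      -- c is the cache when page 0 is requested for the first time.
      run-spiral : ∀ l d h t → t ↭ upFrom (suc l) d → h ≡ suc l + d → l + h ≡ k →
                   ∃[ c ] (t ++ alternate (suc l) h ≡ c ∷ʳ 0) × (c ↭ upFrom 1 k) ×
                          Run t (spiral (suc l) d) (suc l * 2) (evictℕ c ∷ʳ 0)
      run-spiral l d h t t↭ refl l+h≡k = down l refl
        where
        h≤k : h ≤ k
        h≤k = subst (h ≤_) l+h≡k (m≤n+m h l)
        t≤k : All (_≤ k) t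
        t≤k = All.tabulate λ i∈t → ≤-trans (<⇒≤ (proj₂ (∈-upFrom⁻ (∈-resp-↭ t↭ i∈t)))) h≤k
        h∉t : h ∉ t
        h∉t h∈t = <-irrefl refl (proj₂ (∈-upFrom⁻ (∈-resp-↭ t↭ h∈t)))
        length-t : length t ≡ d
        length-t = trans (↭-length t↭) (length-upFrom (suc l) d)
        t+h = t ∷ʳ h
        t+h↭ : t+h ↭ upFrom (suc l) (suc d)
        t+h↭ = ↭-trans (++⁺ʳ List.[ h ] t↭) (↭-reflexive (upFrom-∷ʳ (suc l) d))
        t+h≤k : All (_≤ k) t+h
        t+h≤k = All.tabulate λ {i} i∈ → ≤-trans
          (s≤s⁻¹ (subst (i <_) (+-suc (suc l) d) (proj₂ (∈-upFrom⁻ (∈-resp-↭ t+h↭ i∈))))) h≤k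
        length-t+h : length t+h ≡ suc d
        length-t+h = trans (length-∷ʳ t h) (cong suc length-t)
        up : Run t (upFrom (suc l) (suc d)) 1 t+h
        up = subst (λ I → Run t I 1 t+h) (upFrom-∷ʳ (suc l) d)
          (run-++ (run-hits (All.tabulate λ i∈ → ∈-resp-↭ (↭-sym t↭) i∈))
            (run-room h≤k t≤k h∉t (≤-trans (s≤s (≤-trans (≤-reflexive length-t) (m≤n+m d l))) h≤k) run-[]))
        l∉t+h : l ∉ t+h
        l∉t+h l∈ = <-irrefl refl (proj₁ (∈-upFrom⁻ (∈-resp-↭ t+h↭ l∈)))
        l≤k : l ≤ k
        l≤k = subst (l ≤_) l+h≡k (m≤m+n l h)
        turn : ∀ {n t′ I m t″} → Run t+h List.[ l ] n t′ → Run t′ I m t″ →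
               Run t (upFrom (suc l) (suc d) ++ downTo l (suc d) ++ I) (suc (n + m)) t″
        turn r r′ = run-++ up (run-++ (subst (λ I → Run t+h I _ _) (downTo-∷ʳ l d)
          (run-++ (run-hits (All.tabulate λ i∈ →
            let l<i , i<h = ∈-downTo⁻ i∈
            in ∈-resp-↭ (↭-sym t+h↭) (∈-upFrom⁺ l<i (<-≤-trans i<h (+-monoʳ-≤ (suc l) (n≤1+n d)))))) r)) r′)
        down : ∀ l′ → l ≡ l′ →
               ∃[ c ] (t ++ alternate (suc l) h ≡ c ∷ʳ 0) × (c ↭ upFrom 1 k) ×
                      Run t (spiral (suc l) d) (suc l * 2) (evictℕ c ∷ʳ 0)
        -- Page 0 is the last of the `k + 1` pages and the first to meet a full cache: the only
        -- request of the spiral on which the eviction rule acts.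
        down zero refl =
          t+h , sym (++-assoc t List.[ h ] List.[ 0 ]) , subst (λ n → t+h ↭ upFrom 1 n) l+h≡k t+h↭ ,
          turn (run-full l≤k t+h≤k l∉t+h (trans length-t+h l+h≡k) run-[]) run-[]
        down (suc l′) refl
          with c , eq , c↭ , r ← run-spiral l′ (suc (suc d)) (suc h) (t+h ∷ʳ l)
                 (↭-trans (↭-sym (∷↭∷ʳ l t+h)) (prep l t+h↭))
                 (cong suc (sym (trans (+-suc l′ (suc d)) (cong suc (+-suc l′ d)))))
                 (trans (+-suc l′ h) l+h≡k) =
          c , trans (trans (sym (++-assoc t List.[ h ] _)) (sym (++-assoc t+h List.[ l ] _))) eq , c↭ ,
          turn (run-room l≤k t+h≤k l∉t+h (subst (_< k) (sym length-t+h) 1+d<k) run-[]) r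
          where
          1+d<k : suc d < k
          1+d<k = ≤-trans (s≤s (s≤s (m≤n+m d l′))) h≤k

    -- FWF and FIFO on the zigzag.

    drop-1-map : ∀ t → drop 1 (map v t) ≡ map v (drop 1 t)
    drop-1-map []      = refl
    drop-1-map (_ ∷ _) = refl

    open Runs (drop 1) (drop 1) drop-1-map public using () renaming
      ( Run to RunFIFO; run-++ to FIFO-++; run-^^ to FIFO-^^; run-[] to FIFO-[]
      ; run-room to FIFO-room; run-hit to FIFO-hit; run-hits to FIFO-hits; run-full to FIFO-full
      ; run-spiral to FIFO-spiral; faultsFrom-run to FIFO-run)
    open Runs (λ _ → []) (λ _ → []) (λ _ → refl) public using () renaming
      ( Run to RunFWF; run-hit to FWF-hit; run-++ to FWF-++; run-^^ to FWF-^^; run-[] to FWF-[]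
      ; run-room to FWF-room; run-full to FWF-full
      ; run-spiral to FWF-spiral; faultsFrom-run to FWF-run)

    -- `S` fills the cache exactly and `q` flushes it. In the zigzag, `q` is the end of the path
    -- from which the next sweep starts, so every request is a fault.
    FWF-sweep : ∀ D S q → All (_≤ k) D → All (_≤ k) (S ∷ʳ q) → Unique (S ∷ʳ q) →
                All (_∉ D) (S ∷ʳ q) → length D + length S ≡ k →
                RunFWF D (S ∷ʳ q) (suc (length S)) List.[ q ]
    FWF-sweep D [] q D≤k (q≤k ∷ []) _ (q∉D ∷ []) |D|≡k =
      FWF-full q≤k D≤k q∉D (trans (sym (+-identityʳ _)) |D|≡k) FWF-[]
    FWF-sweep D (s ∷ S) q D≤k (s≤k ∷ S≤k) (s∉S ∷ uS) (s∉D ∷ S∉D) |D|+|S|≡k =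
      FWF-room s≤k D≤k s∉D
        (subst (length D <_) |D|+|S|≡k (m<m+n (length D) (s≤s z≤n)))
        (FWF-sweep (D ∷ʳ s) S q
          (All.tabulate λ i∈ → All.lookup (s≤k ∷ D≤k) (∈-resp-↭ (↭-sym (∷↭∷ʳ s D)) i∈))
          S≤k uS
          (All.zipWith (λ { (s≢x , x∉D) x∈ → D∷ʳs-avoids s≢x x∉D x∈ }) (s∉S , S∉D))
          (trans (cong (_+ length S) (length-∷ʳ D s)) (trans (sym (+-suc _ _)) |D|+|S|≡k)))
      where
      D∷ʳs-avoids : ∀ {x} → ¬ s ≡ x → x ∉ D → x ∉ D ∷ʳ s
      D∷ʳs-avoids s≢x x∉D x∈ with ∈-++⁻ D x∈
      ... | inj₁ x∈D         = x∉D x∈D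
      ... | inj₂ (here refl) = s≢x refl

    FWF-zigzag : RunFWF List.[ 0 ] zigzag (k + k) List.[ 0 ]
    FWF-zigzag = FWF-++
      (subst₂ (λ I n → RunFWF List.[ 0 ] I n List.[ k ]) (upFrom-∷ʳ 1 k-1) (cong suc (length-upFrom 1 k-1))
        (FWF-sweep List.[ 0 ] (upFrom 1 k-1) k (z≤n ∷ [])
          (subst (All (_≤ k)) (sym (upFrom-∷ʳ 1 k-1)) (All.tabulate (s≤s⁻¹ ∘ proj₂ ∘ ∈-upFrom⁻)))
          (subst Unique (sym (upFrom-∷ʳ 1 k-1)) (AllPairs.map <⇒≢ (upFrom-increasing 1 k)))
          (subst (All (_∉ List.[ 0 ])) (sym (upFrom-∷ʳ 1 k-1))
            (All.tabulate λ i∈ → λ { (here refl) → contradiction (proj₁ (∈-upFrom⁻ {1} {k} i∈)) λ () }))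
          (cong suc (length-upFrom 1 k-1))))
      (subst₂ (λ I n → RunFWF List.[ k ] I n List.[ 0 ]) (downTo-∷ʳ 0 k-1) (cong suc length-down)
        (FWF-sweep List.[ k ] (downTo 1 k-1) 0 (≤-refl ∷ [])
          (subst (All (_≤ k)) (sym (downTo-∷ʳ 0 k-1)) (All.tabulate (<⇒≤ ∘ proj₂ ∘ ∈-downTo⁻)))
          (subst Unique (sym (downTo-∷ʳ 0 k-1)) (AllPairs.map >⇒≢ (downTo-decreasing 0 k)))
          (subst (All (_∉ List.[ k ])) (sym (downTo-∷ʳ 0 k-1))
            (All.tabulate λ i∈ → λ { (here refl) → <-irrefl refl (proj₂ (∈-downTo⁻ {0} {k} i∈)) }))
          (cong suc length-down)))
      where
      length-down : length (downTo 1 k-1) ≡ k-1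
      length-down = trans (↭-length (downTo↭upFrom 1 k-1)) (length-upFrom 1 k-1)

    -- The state m ∷ t of FIFO is its cache t together with the one page m of
    -- the path missing from it; a fault on m rotates this list.
    missing-∉ : ∀ {m t} → Order (m ∷ t) → m ∉ t
    missing-∉ o with m∉t ∷ _ ← Order-unique o = All¬⇒¬Any m∉t

    present-∈ : ∀ {m t i} → Order (m ∷ t) → i ≤ k → m ≢ i → i ∈ t
    present-∈ o i≤k m≢i with Order-complete o i≤k
    ... | here refl = contradiction refl m≢i
    ... | there i∈t = i∈t

    FIFO-rotate : ∀ {m a s I n t′} → Order (m ∷ a ∷ s) → RunFIFO (s ∷ʳ m) I n t′ →
                  RunFIFO (a ∷ s) (m ∷ I) (suc n) t′
    FIFO-rotate o r with m≤k ∷ t≤k ← Order-bounded o =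
      FIFO-full m≤k t≤k (missing-∉ o) (suc-injective (Order-length o)) r

    module _ {_≺_ : Rel ℕ 0ℓ} (≺-asym : Asymmetric _≺_) where

      -- The missing page is `a` until it is requested and `b` afterwards, and `b ≺ a` keeps `b` out
      -- of the rest of the sweep. The relation is `<` for sweeps up and `>` for sweeps down.
      FIFO-sweep₁ : ∀ {a b s S} → Order (a ∷ b ∷ s) → AllPairs _≺_ S → All (_≤ k) S →
                    a ∈ S → b ≺ a → RunFIFO (b ∷ s) S 1 (s ∷ʳ a)
      FIFO-sweep₁ o (a≺S ∷ _) (a≤k ∷ S≤k) (here refl) b≺a = FIFO-rotate o
        (FIFO-hits (All.zipWith (λ { (a≺x , x≤k) →
          present-∈ (Order-rotate o) x≤k λ { refl → ≺-asym a≺x b≺a } }) (a≺S , S≤k)))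
      FIFO-sweep₁ o (x≺S ∷ ≺S) (x≤k ∷ S≤k) (there a∈S) b≺a = FIFO-hit
        (present-∈ o x≤k λ { refl → ≺-asym (All.lookup x≺S a∈S) (All.lookup x≺S a∈S) })
        (FIFO-sweep₁ o ≺S S≤k a∈S b≺a)

      -- After the fault on `a` the missing page `a′` still lies ahead because `a ≺ a′`, and a sweep
      -- with one fault remains.
      FIFO-sweep₂ : ∀ {a a′ b s S} → Order (a ∷ a′ ∷ b ∷ s) → AllPairs _≺_ S → All (_≤ k) S →
                    a ∈ S → a′ ∈ S → a ≺ a′ → b ≺ a′ → RunFIFO (a′ ∷ b ∷ s) S 2 (s ∷ʳ a ∷ʳ a′)
      FIFO-sweep₂ o (a≺S ∷ ≺S) (a≤k ∷ S≤k) (here refl) a′∈S a≺a′ b≺a′ with a′∈S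
      ... | here refl = contradiction a≺a′ (≺-asym a≺a′)
      ... | there a′∈ = FIFO-rotate o (FIFO-sweep₁ (Order-rotate o) ≺S S≤k a′∈ b≺a′)
      FIFO-sweep₂ o (x≺S ∷ ≺S) (x≤k ∷ S≤k) (there a∈S) a′∈S a≺a′ b≺a′ with a′∈S
      ... | here refl = contradiction a≺a′ (≺-asym (All.lookup x≺S a∈S))
      ... | there a′∈ = FIFO-hit
        (present-∈ o x≤k λ { refl → ≺-asym (All.lookup x≺S a∈S) (All.lookup x≺S a∈S) })
        (FIFO-sweep₂ o ≺S S≤k a∈S a′∈ a≺a′ b≺a′)

    private
      up≤k : All (_≤ k) (upFrom 1 k)
      up≤k = All.tabulate (s≤s⁻¹ ∘ proj₂ ∘ ∈-upFrom⁻)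
      down≤k : All (_≤ k) (downTo 0 k)
      down≤k = All.tabulate (<⇒≤ ∘ proj₂ ∘ ∈-downTo⁻)

    -- After the fault on `b` the descent is already below the new missing page `c`. An equation
    -- exposes `c` because `s` will be a concatenation whose head does not compute; likewise
    -- `drop 1` of a state is its cache.
    FIFO-down : ∀ {b s c s′} → Order (b ∷ s) → b < k → s ≡ c ∷ s′ → b < c →
                RunFIFO s (downTo 0 k) 1 (drop 1 (s ∷ʳ b))
    FIFO-down o b<k refl b<c =
      FIFO-sweep₁ (λ i>j j>i → <-asym i>j j>i) o (downTo-decreasing 0 k) down≤k (∈-downTo⁺ z≤n b<k) b<c

    -- The fault on `a` going up makes `b` missing, the one on `b` going down makes `c` missing. As
    -- `b` is below both, neither sweep has a second fault.
    FIFO-zigzag : ∀ {a b s c s′} → Order (a ∷ b ∷ s) → b < a → s ∷ʳ a ≡ c ∷ s′ → b < c →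
                  RunFIFO (b ∷ s) zigzag 2 (drop 1 (s ∷ʳ a ∷ʳ b))
    FIFO-zigzag o b<a eq b<c with a≤k ∷ _ ← Order-bounded o = FIFO-++
      -- `b < a` makes `a` positive; the sweep up leaves out page 0, where it starts.
      (FIFO-sweep₁ <-asym o (upFrom-increasing 1 k) up≤k (∈-upFrom⁺ (≤-trans (s≤s z≤n) b<a) (s≤s a≤k)) b<a)
      (FIFO-down (Order-rotate o) (<-≤-trans b<a a≤k) eq b<c)

    -- After the low page `l`, the next missing page is the next high page or, at the end of the
    -- block, `m`. Either exceeds `l`, as the descent to `l` requires.
    alternate-head : ∀ l h m r → 0 < m → l < h →
                     ∃[ c ] ∃[ s ] alternate l h ++ m ∷ r ≡ c ∷ s × l < c
    alternate-head zero    h m r 0<m _   = m , r , refl , 0<m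
    alternate-head (suc l) h m r _   l<h = h , _ , refl , l<h

    -- Each zigzag moves one pair of a high and a low page from the front of the state to the back.
    -- The page `m` is the one missing after the last zigzag.
    FIFO-alternate : ∀ l h m r → Order (alternate l h ++ m ∷ r) → 0 < m → l ≤ h →
                     RunFIFO (drop 1 (alternate l h ++ m ∷ r)) (zigzag ^^ l) (l * 2) (r ++ alternate l h)
    FIFO-alternate zero h m r o 0<m l≤h = subst (RunFIFO r [] 0) (sym (++-identityʳ r)) FIFO-[]
    FIFO-alternate (suc l) h m r o 0<m l<h
      with c , s′ , eq , l<c ← alternate-head l (suc h) m (r ∷ʳ h) 0<m (m<n⇒m<1+n l<h) =
      FIFO-++
        (FIFO-zigzag o l<h (trans (++-assoc s (m ∷ r) List.[ h ]) eq) l<c)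
        (subst₂ (λ ℓ t → RunFIFO (drop 1 ℓ) (zigzag ^^ l) (l * 2) t) (sym eq′) eq″
          (FIFO-alternate l (suc h) m (r ∷ʳ h ∷ʳ l)
            (subst Order eq′ (Order-rotate (Order-rotate o))) 0<m (m≤n⇒m≤1+n (<⇒≤ l<h))))
      where
      s = alternate l (suc h)
      eq′ : (s ++ m ∷ r) ∷ʳ h ∷ʳ l ≡ s ++ m ∷ (r ∷ʳ h ∷ʳ l)
      eq′ = trans (cong (_∷ʳ l) (++-assoc s (m ∷ r) List.[ h ])) (++-assoc s (m ∷ r ∷ʳ h) List.[ l ])
      eq″ : (r ∷ʳ h ∷ʳ l) ++ s ≡ r ++ h ∷ l ∷ s
      eq″ = trans (++-assoc (r ∷ʳ h) List.[ l ] s) (++-assoc r List.[ h ] (l ∷ s))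

    -- The first zigzag is split off so that `h`, moved to the back, can serve as the page behind
    -- the remaining block; `suc l` zigzags rotate the order once round.
    FIFO-cycle-odd : ∀ l h → l < h → Order (alternate (suc l) h) →
                     RunFIFO (l ∷ alternate l (suc h)) (zigzag ^^ suc l) (suc l * 2) (l ∷ alternate l (suc h))
    FIFO-cycle-odd l h l<h o
      with c , s′ , eq , l<c ← alternate-head l (suc h) h [] (≤-trans (s≤s z≤n) l<h) (m<n⇒m<1+n l<h) =
      FIFO-++ (FIFO-zigzag o l<h eq l<c)
        (subst (λ ℓ → RunFIFO (drop 1 ℓ) (zigzag ^^ l) (l * 2) (l ∷ s)) (sym eq′)
          (FIFO-alternate l (suc h) h List.[ l ] (subst Order eq′ (Order-rotate (Order-rotate o)))
            (≤-trans (s≤s z≤n) l<h) (m≤n⇒m≤1+n (<⇒≤ l<h))))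
      where
      s = alternate l (suc h)
      eq′ : s ∷ʳ h ∷ʳ l ≡ s ++ h ∷ List.[ l ]
      eq′ = ++-assoc s List.[ h ] List.[ l ]

    -- The unpaired page `g` forms an ascent with `h`: the first sweep up faults on both and the
    -- first sweep down on `l`. From then on each zigzag takes a pair, with `g` behind the block.
    FIFO-cycle-even : ∀ l g h → 0 < g → g < h → l < h → Order (g ∷ alternate (suc l) h) →
                      RunFIFO (alternate (suc l) h) (zigzag ^^ suc l) (suc (suc l * 2)) (alternate (suc l) h)
    FIFO-cycle-even l g h 0<g g<h l<h o
      with g≤k ∷ h≤k ∷ _ ← Order-bounded o
      with c , s′ , eq , l<c ← alternate-head l (suc h) g List.[ h ] 0<g (m<n⇒m<1+n l<h) =
      FIFO-++
        (FIFO-++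
          (FIFO-sweep₂ <-asym o (upFrom-increasing 1 k) up≤k (∈-upFrom⁺ 0<g (s≤s g≤k))
            (∈-upFrom⁺ (≤-trans 0<g (<⇒≤ g<h)) (s≤s h≤k)) g<h l<h)
          (FIFO-down (Order-rotate (Order-rotate o)) (<-≤-trans l<h h≤k)
            (trans (++-assoc s List.[ g ] List.[ h ]) eq) l<c))
        (subst (λ ℓ → RunFIFO (drop 1 ℓ) (zigzag ^^ l) (l * 2) (h ∷ l ∷ s)) (sym eq′)
          (FIFO-alternate l (suc h) g (h ∷ List.[ l ])
            (subst Order eq′ (Order-rotate (Order-rotate (Order-rotate o))))
            0<g (m≤n⇒m≤1+n (<⇒≤ l<h))))
      where
      s = alternate l (suc h)
      eq′ : s ∷ʳ g ∷ʳ h ∷ʳ l ≡ s ++ g ∷ h ∷ List.[ l ]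
      eq′ = trans (++-assoc (s ∷ʳ g) List.[ h ] List.[ l ]) (++-assoc s List.[ g ] (h ∷ List.[ l ]))

-- Comparing fractions by cross-multiplication.

toℚᵘ-/ : ∀ u w .{{_ : NonZero w}} → toℚᵘ (u / w) ℚᵘ.≃ (u ℚᵘ./ w)
toℚᵘ-/ u (suc w) = ℚ.toℚᵘ-fromℚᵘ (mkℚᵘ u w)

*<⇒</ : ∀ {r u w} .{{_ : NonZero w}} → ↥ r ℤ.* + w ℤ.< u ℤ.* ↧ r → r ℚ.< u / w
*<⇒</ {r@record{}} {u} {w@(suc _)} lt =
  ℚ.toℚᵘ-cancel-< (ℚᵘ.<-respʳ-≃ (ℚᵘ.≃-sym (toℚᵘ-/ u w)) (ℚᵘ.*<* lt))

</⇒*< : ∀ {r u w} .{{_ : NonZero w}} → r ℚ.< u / w → ↥ r ℤ.* + w ℤ.< u ℤ.* ↧ r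
</⇒*< {r@record{}} {u} {w@(suc _)} lt =
  ℚᵘ.drop-*<* (ℚᵘ.<-respʳ-≃ (toℚᵘ-/ u w) (ℚ.toℚᵘ-mono-< lt))

/<⇒*< : ∀ {r u w} .{{_ : NonZero w}} → u / w ℚ.< r → u ℤ.* ↧ r ℤ.< ↥ r ℤ.* + w
/<⇒*< {r@record{}} {u} {w@(suc _)} lt =
  ℚᵘ.drop-*<* (ℚᵘ.<-respˡ-≃ (toℚᵘ-/ u w) (ℚ.toℚᵘ-mono-< lt))

toℚᵘ-*/1 : ∀ r n → toℚᵘ (r ℚ.* (+ n / 1)) ℚᵘ.≃ toℚᵘ r ℚᵘ.* mkℚᵘ (+ n) 0
toℚᵘ-*/1 r n = ℚᵘ.≃-trans (ℚ.toℚᵘ-homo-* r (+ n / 1))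
                          (ℚᵘ.*-congˡ {toℚᵘ r} (toℚᵘ-/ (+ n) 1))

*<⇒*/1<fromℤ : ∀ r n z → ↥ r ℤ.* + n ℤ.< z ℤ.* ↧ r → r ℚ.* (+ n / 1) ℚ.< z / 1
*<⇒*/1<fromℤ r@record{} n z lt = ℚ.toℚᵘ-cancel-<
  (ℚᵘ.<-respˡ-≃ (ℚᵘ.≃-sym (toℚᵘ-*/1 r n))
    (ℚᵘ.<-respʳ-≃ (ℚᵘ.≃-sym (toℚᵘ-/ z 1))
      (ℚᵘ.*<* (subst₂ ℤ._<_ (sym (ℤ.*-identityʳ _))
        (cong (λ d → z ℤ.* + d) (sym (*-identityʳ (↧ₙ r)))) lt))))

*/1<fromℤ⇒*< : ∀ r n z → r ℚ.* (+ n / 1) ℚ.< z / 1 → ↥ r ℤ.* + n ℤ.< z ℤ.* ↧ r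
*/1<fromℤ⇒*< r@record{} n z lt = subst₂ ℤ._<_ (ℤ.*-identityʳ _)
  (cong (λ d → z ℤ.* + d) (*-identityʳ (↧ₙ r)))
  (ℚᵘ.drop-*<* (ℚᵘ.<-respˡ-≃ (toℚᵘ-*/1 r n) (ℚᵘ.<-respʳ-≃ (toℚᵘ-/ z 1) (ℚ.toℚᵘ-mono-< lt))))

1-1/n≡[n-1]/n : ∀ n .{{_ : NonZero n}} → 1ℚ ℚ.- + 1 / n ≡ (+ n ℤ.- + 1) / n
1-1/n≡[n-1]/n n@(suc m) = ℚ.toℚᵘ-injective (begin
  toℚᵘ (1ℚ ℚ.- + 1 / n)                  ≈⟨ ℚ.toℚᵘ-homo-+ 1ℚ (ℚ.- (+ 1 / n)) ⟩
  toℚᵘ 1ℚ ℚᵘ.+ toℚᵘ (ℚ.- (+ 1 / n))      ≈⟨ ℚᵘ.+-congʳ (toℚᵘ 1ℚ) (ℚ.toℚᵘ-homo‿- (+ 1 / n)) ⟩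
  toℚᵘ 1ℚ ℚᵘ.- toℚᵘ (+ 1 / n)            ≈⟨ ℚᵘ.+-congʳ (toℚᵘ 1ℚ) (ℚᵘ.-‿cong (toℚᵘ-/ (+ 1) n)) ⟩
  toℚᵘ 1ℚ ℚᵘ.- mkℚᵘ (+ 1) m              ≈⟨ ℚᵘ.*≡* (cong₂ (λ i d → i ℤ.* + d) eq (sym (*-identityˡ n))) ⟩
  mkℚᵘ (+ n ℤ.- + 1) m                   ≈⟨ toℚᵘ-/ (+ n ℤ.- + 1) n ⟨
  toℚᵘ ((+ n ℤ.- + 1) / n)               ∎)
  where
  open ℚᵘ.≃-Reasoning
  eq : + 1 ℤ.* + n ℤ.+ (ℤ.- + 1) ℤ.* + 1 ≡ + n ℤ.- + 1
  eq = cong (ℤ._- + 1) (ℤ.*-identityˡ (+ n))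

i≤+∣i∣ : ∀ i → i ℤ.≤ + ℤ.∣ i ∣
i≤+∣i∣ (+ n)    = ℤ.≤-refl
i≤+∣i∣ -[1+ n ] = ℤ.-≤+

-- Limits of the difference per request.

module _ (G : Graph) (A B : List (Graph.Vertex G) → ℕ) where

  difference : List (Graph.Vertex G) → ℤ
  difference I = + A I ℤ.- + B I

  0≤liminf-Min : (∀ I → B I ≤ A I) → ι 0ℚ ≤∞ liminf (λ n → Min G A B (suc n) ÷ suc n)
  0≤liminf-Min B≤A {q} q<0 with r , q<r , r<0 ← ℚ.<-dense q<0 =
    0 , r , q<r , λ (n , _) →
      -- The cut of an infimum asks for one margin valid for all sequences; any number strictly
      -- between `r` times the length and 0 will do.
      let r′ , rn<r′ , r′<0 = ℚ.<-dense {r ℚ.* (+ suc n / 1)} {0ℚ}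
                                (*<⇒*/1<fromℤ r (suc n) (+ 0) (neg n r<0))
      in r′ , rn<r′ , λ (I , _) → ℚ.<-≤-trans r′<0 (0≤ I)
    where
    neg : ∀ {r} n → r ℚ.< 0ℚ → ↥ r ℤ.* + suc n ℤ.< + 0 ℤ.* ↧ r
    neg {r} n r<0 = ℤ.*-monoʳ-<-pos (+ suc n) {↥ r} {+ 0}
      (subst (ℤ._< + 0) (ℤ.*-identityʳ (↥ r)) (</⇒*< {r} {+ 0} {1} r<0))
    0≤ : ∀ I → 0ℚ ℚ.≤ difference I / 1
    0≤ I = ℚ.≮⇒≥ λ d<0 → ℤ.<⇒≱ (/<⇒*< {0ℚ} {difference I} {1} d<0)
      (subst (+ 0 ℤ.≤_) (sym (ℤ.*-identityʳ (difference I))) (ℤ.i≤j⇒0≤j-i (ℤ.+≤+ (B≤A I))))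

  liminf-Min≤0 : (∀ n → Σ[ (I , _) ∈ Requests G (suc n) ] A I ≡ B I) →
                 liminf (λ n → Min G A B (suc n) ÷ suc n) ≤∞ ι 0ℚ
  liminf-Min≤0 A≡B (N , r , q<r , below-Min)
    with r′ , rn<r′ , r′<diff ← below-Min (N , ≤-refl)
    with I , eq ← A≡B N = ℚ.<-trans q<r r<0
    where
    diff≡0 : difference (proj₁ I) ≡ + 0
    diff≡0 = trans (cong (λ n → + n ℤ.- + B (proj₁ I)) eq) (ℤ.+-inverseʳ (+ B (proj₁ I)))
    r<0 : r ℚ.< 0ℚ
    r<0 = *<⇒</ {r} {+ 0} {1} (subst (ℤ._< + 0) (sym (ℤ.*-identityʳ (↥ r)))
      (ℤ.*-cancelʳ-<-nonNeg {↥ r} {+ 0} (+ suc N)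
        (*/1<fromℤ⇒*< r (suc N) (+ 0)
          (ℚ.<-trans rn<r′ (subst (λ z → r′ ℚ.< z / 1) diff≡0 (r′<diff I))))))

  limsup-Max≤ : ∀ u w .{{_ : NonZero w}} C →
                (∀ n ((I , _) : Requests G n) → + w ℤ.* difference I ℤ.≤ u ℤ.* + n ℤ.+ + C) →
                limsup (λ n → Max G A B (suc n) ÷ suc n) ≤∞ ι (u / w)
  limsup-Max≤ u w@(suc _) C bound {q} (r , q<r , below-sup) =
    ℚ.<-≤-trans q<r (ℚ.≮⇒≥ λ u/w<r →
      -- If `u / w < r`, the integers `u * ↧ r` and `↥ r * w` differ by at least 1, hence by at
      -- least `suc n` after multiplication by `suc n`. For `n ≥ C * d` this exceeds the
      -- contribution `C * d` of the constant.
      let d = ↧ₙ r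
          (n , Cd≤n) , I , lt = below-sup (C * d)
          δ = difference (proj₁ I)
          rn<δ = */1<fromℤ⇒*< r (suc n) δ lt
          open ℤ.≤-Reasoning
          Cd : + (C * d) ℤ.≤ + n
          Cd = ℤ.+≤+ Cd≤n
      in ℤ.<-irrefl refl (begin-strict
        u ℤ.* ↧ r ℤ.* + suc n ℤ.+ + n
          <⟨ ℤ.+-monoʳ-< (u ℤ.* ↧ r ℤ.* + suc n) (ℤ.+<+ (n<1+n n)) ⟩
        u ℤ.* ↧ r ℤ.* + suc n ℤ.+ + suc n
          ≡⟨ expand (u ℤ.* ↧ r) (+ suc n) ⟩
        (+ 1 ℤ.+ u ℤ.* ↧ r) ℤ.* + suc n
          ≤⟨ ℤ.*-monoʳ-≤-nonNeg (+ suc n) (ℤ.i<j⇒suc[i]≤j (/<⇒*< {r} {u} {w} u/w<r)) ⟩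
        ↥ r ℤ.* + w ℤ.* + suc n
          ≡⟨ move (↥ r) (+ w) (+ suc n) ⟩
        + w ℤ.* (↥ r ℤ.* + suc n)
          ≤⟨ ℤ.*-monoˡ-≤-nonNeg (+ w) (ℤ.<⇒≤ rn<δ) ⟩
        + w ℤ.* (δ ℤ.* ↧ r)
          ≡⟨ ℤ.*-assoc (+ w) δ (↧ r) ⟨
        + w ℤ.* δ ℤ.* ↧ r
          ≤⟨ ℤ.*-monoʳ-≤-nonNeg (↧ r) (bound (suc n) I) ⟩
        (u ℤ.* + suc n ℤ.+ + C) ℤ.* ↧ r
          ≡⟨ distribute u (+ suc n) (+ C) (↧ r) ⟩
        u ℤ.* ↧ r ℤ.* + suc n ℤ.+ + C ℤ.* ↧ r
          ≡⟨ cong (ℤ._+_ (u ℤ.* ↧ r ℤ.* + suc n)) (ℤ.pos-* C d) ⟨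
        u ℤ.* ↧ r ℤ.* + suc n ℤ.+ + (C * d)
          ≤⟨ ℤ.+-monoʳ-≤ (u ℤ.* ↧ r ℤ.* + suc n) Cd ⟩
        u ℤ.* ↧ r ℤ.* + suc n ℤ.+ + n ∎))
    where
    expand : ∀ x n → x ℤ.* n ℤ.+ n ≡ (+ 1 ℤ.+ x) ℤ.* n
    expand = ℤ-Solver.solve-∀
    move : ∀ p w n → p ℤ.* w ℤ.* n ≡ w ℤ.* (p ℤ.* n)
    move = ℤ-Solver.solve-∀
    distribute : ∀ u n c d → (u ℤ.* n ℤ.+ c) ℤ.* d ≡ u ℤ.* d ℤ.* n ℤ.+ c ℤ.* d
    distribute = ℤ-Solver.solve-∀

  -- `L` stands for the length of a prefix that contributes nothing, `w` for that of a period that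
  -- contributes `u`.
  ≤limsup-Max : ∀ u w .{{_ : NonZero w}} L →
                (∀ m₀ → ∃[ m ] m₀ ≤ m × ∃[ n ] Σ[ (I , _) ∈ Requests G (suc n) ]
                   suc n ≡ L + m * w × difference I ≡ + m ℤ.* u) →
                ι (u / w) ≤∞ limsup (λ n → Max G A B (suc n) ÷ suc n)
  ≤limsup-Max u w@(suc w-1) L family {q} q<u/w with r , q<r , r<u/w ← ℚ.<-dense q<u/w =
    r , q<r , λ N →
      -- The summand `N` puts the index `n` at `N` or later. The other makes `m` exceed the loss
      -- `↥ r * L` due to the prefix, since `m` periods gain at least `m` by integrality.
      let m , m₀≤m , n , I , n≡ , δ≡ = family (suc (N + ℤ.∣ ↥ r ∣ * L))
          m≤n : m ≤ suc n
          m≤n = subst (m ≤_) (sym n≡) (≤-trans (m≤m*n m w) (m≤n+m (m * w) L))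
          open ℤ.≤-Reasoning
          rL<m : ↥ r ℤ.* + L ℤ.< + m
          rL<m = begin-strict
            ↥ r ℤ.* + L               ≤⟨ ℤ.*-monoʳ-≤-nonNeg (+ L) (i≤+∣i∣ (↥ r)) ⟩
            + ℤ.∣ ↥ r ∣ ℤ.* + L       ≡⟨ ℤ.pos-* ℤ.∣ ↥ r ∣ L ⟨
            + (ℤ.∣ ↥ r ∣ * L)         <⟨ ℤ.+<+ (≤-trans (s≤s (m≤n+m _ N)) m₀≤m) ⟩
            + m                       ∎
      in (n , s≤s⁻¹ (≤-trans (s≤s (m≤m+n N _)) (≤-trans m₀≤m m≤n))) , I ,
         *<⇒*/1<fromℤ r (suc n) (difference (proj₁ I)) (begin-strict
           ↥ r ℤ.* + suc n
             ≡⟨ cong (λ x → ↥ r ℤ.* + x) n≡ ⟩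
           ↥ r ℤ.* + (L + m * w)
             ≡⟨ cong (↥ r ℤ.*_) (trans (ℤ.pos-+ L (m * w)) (cong (ℤ._+_ (+ L)) (ℤ.pos-* m w))) ⟩
           ↥ r ℤ.* (+ L ℤ.+ + m ℤ.* + w)
             ≡⟨ split (↥ r) (+ L) (+ m) (+ w) ⟩
           ↥ r ℤ.* + L ℤ.+ + m ℤ.* (↥ r ℤ.* + w)
             <⟨ ℤ.+-monoˡ-< (+ m ℤ.* (↥ r ℤ.* + w)) rL<m ⟩
           + m ℤ.+ + m ℤ.* (↥ r ℤ.* + w)
             ≡⟨ factor (+ m) (↥ r ℤ.* + w) ⟩
           + m ℤ.* (+ 1 ℤ.+ ↥ r ℤ.* + w)
             ≤⟨ ℤ.*-monoˡ-≤-nonNeg (+ m) (ℤ.i<j⇒suc[i]≤j (</⇒*< {r} {u} {w} r<u/w)) ⟩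
           + m ℤ.* (u ℤ.* ↧ r)
             ≡⟨ ℤ.*-assoc (+ m) u (↧ r) ⟨
           + m ℤ.* u ℤ.* ↧ r
             ≡⟨ cong (ℤ._* ↧ r) δ≡ ⟨
           difference (proj₁ I) ℤ.* ↧ r ∎)
    where
    split : ∀ p l m w → p ℤ.* (l ℤ.+ m ℤ.* w) ≡ p ℤ.* l ℤ.+ m ℤ.* (p ℤ.* w)
    split = ℤ-Solver.solve-∀
    factor : ∀ m x → m ℤ.+ m ℤ.* x ≡ m ℤ.* (+ 1 ℤ.+ x)
    factor = ℤ-Solver.solve-∀

-- Request sequences in `G` and the endpoints of the interval.

length-^^ : {A : Set} (xs : List A) (n : ℕ) → length (xs ^^ n) ≡ n * length xs
length-^^ xs zero    = refl
length-^^ xs (suc n) = trans (length-++ xs) (cong (_+_ (length xs)) (length-^^ xs n))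

parity : ∀ n → (∃[ l ] n ≡ l + l) ⊎ (∃[ l ] n ≡ l + suc l)
parity zero = inj₁ (0 , refl)
parity (suc n) with parity n
... | inj₁ (l , n≡) = inj₂ (l , trans (cong suc n≡) (sym (+-suc l l)))
... | inj₂ (l , n≡) = inj₁ (suc l , cong suc n≡)

module OnPath (k-1 : ℕ) (G : Graph) (P : Path G (suc k-1)) where
  open Graph G
  open Path P

  open Zigzag k-1

  private
    k = suc k-1

  -- junk value: the last vertex for i > k
  v : ℕ → Vertex
  v i = vertex (fromℕ< (s≤s (m⊓n≤m k i)))

  toℕ-index : ∀ {i} → i ≤ k → toℕ (fromℕ< (s≤s (m⊓n≤m k i))) ≡ i
  toℕ-index i≤k = trans (Fin.toℕ-fromℕ< _) (m≥n⇒m⊓n≡n i≤k)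

  v-injective : ∀ {i j} → i ≤ k → j ≤ k → v i ≡ v j → i ≡ j
  v-injective i≤k j≤k eq =
    trans (sym (toℕ-index i≤k)) (trans (cong toℕ (distinct eq)) (toℕ-index j≤k))

  v-adjacent : ∀ {i} → i < k → v i ~ v (suc i)
  v-adjacent {i} i<k = subst₂ (λ a b → vertex a ~ vertex b)
    (Fin.toℕ-injective (trans (Fin.toℕ-inject₁ j) (trans (Fin.toℕ-fromℕ< i<k) (sym (toℕ-index (<⇒≤ i<k))))))
    (Fin.toℕ-injective (trans (cong suc (Fin.toℕ-fromℕ< i<k)) (sym (toℕ-index i<k))))
    (adjacent j)
    where j = fromℕ< i<k

  open PathPages G v v-injective

  walk-linked : ∀ {i I j} → Walk i I j → Respects G (map v (i ∷ I))
  walk-linked [] = [-]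
  walk-linked ((i≤k , j≤k , inj₁ i≡j) ∷ w) = inj₁ (cong v i≡j) ∷ walk-linked w
  walk-linked ((i≤k , j≤k , inj₂ (inj₁ refl)) ∷ w) = inj₂ (v-adjacent j≤k) ∷ walk-linked w
  walk-linked ((i≤k , j≤k , inj₂ (inj₂ refl)) ∷ w) = inj₂ (~-sym (v-adjacent i≤k)) ∷ walk-linked w

  requests : ∀ {i I j n} → Walk i I j → length I ≡ n → Requests G n
  requests {I = I} w |I|≡n =
    map v I , Linked.tail (walk-linked w) , trans (length-map v I) |I|≡n

  FIFO-faults : ∀ {I n t} → RunFIFO [] I n t → FIFO G k (map v I) ≡ n
  FIFO-faults {I} {n} r = trans (cong (FIFO G k) (sym (++-identityʳ (map v I))))
    (trans (FIFO-run r []) (+-identityʳ n))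

  FWF-faults : ∀ {I n t} → RunFWF [] I n t → FWF G k (map v I) ≡ n
  FWF-faults {I} {n} r = trans (cong (FWF G k) (sym (++-identityʳ (map v I))))
    (trans (FWF-run r []) (+-identityʳ n))

  -- Page 0 is repeated; both algorithms fault on the first request only.
  constant-requests : ∀ n → Σ[ (I , _) ∈ Requests G (suc n) ] FWF G k I ≡ FIFO G k I
  constant-requests n =
    requests (walk-^^ (suc n) ((z≤n , z≤n , inj₁ refl) ∷ []))
             (trans (length-^^ List.[ 0 ] (suc n)) (*-identityʳ (suc n))) ,
    trans
      (FWF-faults (FWF-room z≤n [] (λ ()) (s≤s z≤n)
        (FWF-^^ n (FWF-hit (here refl) FWF-[]))))
      (sym (FIFO-faults (FIFO-room z≤n [] (λ ()) (s≤s z≤n)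
        (FIFO-^^ n (FIFO-hit (here refl) FIFO-[])))))

  length-zigzag : length zigzag ≡ k + k
  length-zigzag = trans (length-++ (upFrom 1 k))
    (cong₂ _+_ (length-upFrom 1 k) (trans (↭-length (downTo↭upFrom 0 k)) (length-upFrom 0 k)))

  -- Both algorithms fault equally often on the prefix, which therefore cancels. FWF faults on every
  -- request of a cycle, so `period` counts its faults too, and a cycle contributes
  -- `period - (k + 1)`.
  record Periodic (period : ℕ) : Set where
    field
      {start zigzags prefixFaults L} : ℕ
      {prefix cache}  : List ℕ
      prefix-walk     : Walk start prefix 0
      prefix-length   : length prefix ≡ suc L
      prefix-FIFO     : RunFIFO [] prefix prefixFaults cache
      prefix-FWF      : RunFWF [] prefix prefixFaults List.[ 0 ]
      cycle-FIFO      : RunFIFO cache (zigzag ^^ zigzags) (suc k) cache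
      period≡         : zigzags * (k + k) ≡ period

    repetition : ∀ m → Σ[ (I , _) ∈ Requests G (suc (L + m * period)) ]
                 difference G (FWF G k) (FIFO G k) I ≡ + m ℤ.* (+ period ℤ.- + suc k)
    repetition m =
      requests ((prefix-walk ++ʷ walk-^^ m (walk-^^ zigzags walk-zigzag)))
        (trans (length-++ prefix) (cong₂ _+_ prefix-length
          (trans (length-^^ (zigzag ^^ zigzags) m)
            (cong (m *_) (trans (length-^^ zigzag zigzags)
              (trans (cong (zigzags *_) length-zigzag) period≡)))))) ,
      (begin
        + FWF G k I ℤ.- + FIFO G k I
          ≡⟨ cong₂ (λ a b → + a ℤ.- + b)
               (FWF-faults (FWF-++ prefix-FWF (FWF-^^ m
                 (FWF-^^ zigzags FWF-zigzag))))
               (FIFO-faults (FIFO-++ prefix-FIFO (FIFO-^^ m cycle-FIFO))) ⟩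
        + (prefixFaults + m * (zigzags * (k + k))) ℤ.- + (prefixFaults + m * suc k)
          ≡⟨ cong (λ p → + (prefixFaults + m * p) ℤ.- + (prefixFaults + m * suc k)) period≡ ⟩
        + (prefixFaults + m * period) ℤ.- + (prefixFaults + m * suc k)
          ≡⟨ cong₂ ℤ._-_ (pos-+* period) (pos-+* (suc k)) ⟩
        (+ prefixFaults ℤ.+ + m ℤ.* + period) ℤ.- (+ prefixFaults ℤ.+ + m ℤ.* + suc k)
          ≡⟨ cancel (+ prefixFaults) (+ m) (+ period) (+ suc k) ⟩
        + m ℤ.* (+ period ℤ.- + suc k) ∎)
      where
      open ≡-Reasoning
      I = map v (prefix ++ (zigzag ^^ zigzags) ^^ m)
      pos-+* : ∀ x → + (prefixFaults + m * x) ≡ + prefixFaults ℤ.+ + m ℤ.* + x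
      pos-+* x = trans (ℤ.pos-+ prefixFaults (m * x)) (cong (ℤ._+_ (+ prefixFaults)) (ℤ.pos-* m x))
      cancel : ∀ a m p q → (a ℤ.+ m ℤ.* p) ℤ.- (a ℤ.+ m ℤ.* q) ≡ m ℤ.* (p ℤ.- q)
      cancel = ℤ-Solver.solve-∀

  Order-spiral : ∀ {ℓ c} → ℓ ≡ c ∷ʳ 0 → c ↭ upFrom 1 k → Order ℓ
  Order-spiral {c = c} refl c↭ = ↭-trans (↭-sym (∷↭∷ʳ 0 c)) (prep 0 c↭)

  -- The first fault with a full cache evicts the page visited first, so the order of first visits
  -- is then itself the FIFO state, with its head missing.
  drop-1-snoc : ∀ {a b : ℕ} {s c x} → a ∷ b ∷ s ≡ c ∷ʳ x → drop 1 c ∷ʳ x ≡ b ∷ s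
  drop-1-snoc {c = []}    ()
  drop-1-snoc {c = _ ∷ _} eq = sym (proj₂ (∷-injective eq))

  periodic-odd : ∀ l → k ≡ l + suc l → Periodic (suc k * k)
  periodic-odd l k≡
    with h≡ ← sym (+-identityʳ (suc l))
    -- There are `2 * suc l` pages: starting with none visited, the spiral pairs off all of them.
    with c , eq , c↭ , r ← FIFO-spiral l 0 (suc l) [] ↭-refl h≡ (sym k≡)
       | _ , _ , _ , r′ ← FWF-spiral l 0 (suc l) [] ↭-refl h≡ (sym k≡) = record
    { zigzags       = suc l
    ; prefix-walk   = walk-spiral l 0 (trans (cong (_+_ l) (+-identityʳ (suc l))) (sym k≡))
    ; prefix-length = refl
    ; prefix-FIFO   = subst (RunFIFO [] _ _) (drop-1-snoc eq) r
    ; prefix-FWF    = r′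
    ; cycle-FIFO    = subst (λ n → RunFIFO cache (zigzag ^^ suc l) n cache)
                        (trans (*-comm (suc l) 2) (trans (2* l) (cong suc (sym k≡))))
                        (FIFO-cycle-odd l (suc l) ≤-refl (Order-spiral eq c↭))
    ; period≡       = trans (double (suc l) k) (cong (_* k) (trans (2* l) (cong suc (sym k≡))))
    }
    where
    cache = l ∷ alternate l (suc (suc l))
    2* : ∀ l → 2 * suc l ≡ suc (l + suc l)
    2* = ℕ-Solver.solve-∀
    double : ∀ p k → p * (k + k) ≡ 2 * p * k
    double = ℕ-Solver.solve-∀

  periodic-even : ∀ l → k ≡ suc l + suc l → Periodic (k * k)
  periodic-even l k≡
    with l+h≡k ← trans (+-suc l (suc l)) (sym k≡)
    -- The number of pages is odd: the middle page `suc l` is requested beforehand and the others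
    -- pair off around it.
    with c , eq , c↭ , r ← FIFO-spiral l 1 (suc (suc l)) List.[ suc l ] ↭-refl (+-comm 1 (suc l)) l+h≡k
       | _ , _ , _ , r′ ← FWF-spiral l 1 (suc (suc l)) List.[ suc l ] ↭-refl (+-comm 1 (suc l)) l+h≡k = record
    { start         = suc l
    ; zigzags       = suc l
    ; prefix-walk   = (1+l≤k , 1+l≤k , inj₁ refl) ∷ walk-spiral l 1 (trans (cong (_+_ l) (+-comm (suc l) 1)) l+h≡k)
    ; prefix-length = refl
    ; prefix-FIFO   = FIFO-room 1+l≤k [] (λ ()) (s≤s z≤n)
                        (subst (RunFIFO List.[ suc l ] _ _) (drop-1-snoc eq) r)
    ; prefix-FWF    = FWF-room 1+l≤k [] (λ ()) (s≤s z≤n) r′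
    ; cycle-FIFO    = subst (λ n → RunFIFO cache (zigzag ^^ suc l) n cache)
                        (cong suc (trans (*2 (suc l)) (sym k≡)))
                        (FIFO-cycle-even l (suc l) (suc (suc l)) (s≤s z≤n) ≤-refl (n≤1+n _)
                          (Order-spiral eq c↭))
    ; period≡       = trans (double (suc l) k) (cong (_* k) (sym k≡))
    }
    where
    cache = alternate (suc l) (suc (suc l))
    1+l≤k : suc l ≤ k
    1+l≤k = subst (suc l ≤_) (sym k≡) (m≤m+n (suc l) (suc l))
    *2 : ∀ p → p * 2 ≡ p + p
    *2 = ℕ-Solver.solve-∀
    double : ∀ p k → p * (k + k) ≡ (p + p) * k
    double = ℕ-Solver.solve-∀

  0≤liminf : ι 0ℚ ≤∞ liminf (λ n → Min G (FWF G k) (FIFO G k) (suc n) ÷ suc n)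
  0≤liminf = 0≤liminf-Min G (FWF G k) (FIFO G k) (FIFO≤FWF G k (s≤s z≤n))

  liminf≤0 : liminf (λ n → Min G (FWF G k) (FIFO G k) (suc n) ÷ suc n) ≤∞ ι 0ℚ
  liminf≤0 = liminf-Min≤0 G (FWF G k) (FIFO G k) constant-requests

  limsup≤ : limsup (λ n → Max G (FWF G k) (FIFO G k) (suc n) ÷ suc n) ≤∞ ι ((+ k ℤ.- + 1) / k)
  limsup≤ = limsup-Max≤ G (FWF G k) (FIFO G k) (+ k ℤ.- + 1) k k bound
    where
    open ℤ.≤-Reasoning
    expand : ∀ x F f → (+ 1 ℤ.+ x) ℤ.* (F ℤ.- f) ≡ x ℤ.* F ℤ.+ (F ℤ.- (+ 1 ℤ.+ x) ℤ.* f)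
    expand = ℤ-Solver.solve-∀
    cancel : ∀ x n kf k → x ℤ.* n ℤ.+ (kf ℤ.+ k ℤ.- kf) ≡ x ℤ.* n ℤ.+ k
    cancel = ℤ-Solver.solve-∀
    bound : ∀ n ((I , _) : Requests G n) →
            + k ℤ.* difference G (FWF G k) (FIFO G k) I ℤ.≤ (+ k ℤ.- + 1) ℤ.* + n ℤ.+ + k
    -- The two bounds `F ≤ n` and `F ≤ k * f + k` combine through
    -- `k * (F - f) = (k - 1) * F + (F - k * f)`.
    bound n (I , _ , |I|≡n) = begin
      + k ℤ.* (+ F ℤ.- + f)
        ≡⟨ expand (+ k-1) (+ F) (+ f) ⟩
      + k-1 ℤ.* + F ℤ.+ (+ F ℤ.- + k ℤ.* + f)
        ≤⟨ ℤ.+-mono-≤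
             (ℤ.*-monoˡ-≤-nonNeg (+ k-1) (ℤ.+≤+ (subst (F ≤_) |I|≡n (faultsFrom≤length G k (λ _ → []) [] I))))
             (ℤ.+-monoˡ-≤ (ℤ.- (+ k ℤ.* + f)) (subst (+ F ℤ.≤_)
               (trans (ℤ.pos-+ (k * f) k) (cong (ℤ._+ + k) (ℤ.pos-* k f)))
               (ℤ.+≤+ (FWF≤k*FIFO+k G k (s≤s z≤n) I)))) ⟩
      + k-1 ℤ.* + n ℤ.+ (+ k ℤ.* + f ℤ.+ + k ℤ.- + k ℤ.* + f)
        ≡⟨ cancel (+ k-1) (+ n) (+ k ℤ.* + f) (+ k) ⟩
      + k-1 ℤ.* + n ℤ.+ + k ∎
      where
      F = FWF G k I
      f = FIFO G k I

  ≤limsup-odd : ∀ l → k ≡ l + suc l →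
                ι ((+ k ℤ.- + 1) / k) ≤∞ limsup (λ n → Max G (FWF G k) (FIFO G k) (suc n) ÷ suc n)
  ≤limsup-odd l k≡ = ≤limsup-Max G (FWF G k) (FIFO G k) (+ k ℤ.- + 1) k (suc L) λ m →
    let I , eq = repetition m in
    -- A period of `suc k * k` requests gains `suc k * (k - 1)`: it counts as `suc k` blocks of `k`
    -- requests gaining `k - 1` each.
    m * suc k , m≤m*n m (suc k) , _ , I ,
    cong (λ x → suc L + x) (sym (*-assoc m (suc k) k)) ,
    trans eq (trans (cong (λ x → + m ℤ.* (x ℤ.- + suc k)) (ℤ.pos-* (suc k) k))
      (trans (factor (+ m) (+ k)) (cong (ℤ._* (+ k ℤ.- + 1)) (sym (ℤ.pos-* m (suc k))))))
    where
    open Periodic (periodic-odd l k≡)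
    factor : ∀ m k → m ℤ.* ((+ 1 ℤ.+ k) ℤ.* k ℤ.- (+ 1 ℤ.+ k)) ≡ m ℤ.* (+ 1 ℤ.+ k) ℤ.* (k ℤ.- + 1)
    factor = ℤ-Solver.solve-∀

  ≤limsup-even : ∀ l → k ≡ suc l + suc l →
                 ι (_/_ (+ (k ^ 2) ℤ.- + k ℤ.- + 1) (k ^ 2) {{m^n≢0 k 2}}) ≤∞
                 limsup (λ n → Max G (FWF G k) (FIFO G k) (suc n) ÷ suc n)
  ≤limsup-even l k≡ = ≤limsup-Max G (FWF G k) (FIFO G k) (+ (k ^ 2) ℤ.- + k ℤ.- + 1) (k ^ 2) {{m^n≢0 k 2}} (suc L) λ m →
    let I , eq = repetition m in
    m , ≤-refl , _ , I ,
    cong (λ x → suc L + m * x) (sym k^2≡) ,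
    trans eq (cong (+ m ℤ.*_) (trans (cong (λ x → + x ℤ.- + suc k) (sym k^2≡)) (split (+ (k ^ 2)) (+ k))))
    where
    open Periodic (periodic-even l k≡)
    k^2≡ : k ^ 2 ≡ k * k
    k^2≡ = cong (k *_) (*-identityʳ k)
    split : ∀ x k → x ℤ.- (+ 1 ℤ.+ k) ≡ x ℤ.- k ℤ.- + 1
    split = ℤ-Solver.solve-∀

theorem3 : ∀ (k : ℕ) .{{_ : NonZero k}} (G : Graph) → Path G k →
    (2 ∤ k → relativeInterval G (FWF G k) (FIFO G k) ≐ [ ι 0ℚ , ι (1ℚ - + 1 / k) ])
    ×
    (2 ∣ k →
    [ ι 0ℚ , ι (_/_ (+ (k ^ 2) ℤ.- + k ℤ.- + 1) (k ^ 2) {{m^n≢0 k 2}}) ]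
    ⊆ relativeInterval G (FWF G k) (FIFO G k)
    ×
    relativeInterval G (FWF G k) (FIFO G k)
    ⊆ [ ι 0ℚ , ι ((+ k ℤ.- + 1) / k) ])
theorem3 zero = contradiction refl (≢-nonZero⁻¹ 0)
theorem3 k@(suc k-1) G P = odd , even
  where
  open OnPath k-1 G P
  odd : 2 ∤ k → relativeInterval G (FWF G k) (FIFO G k) ≐ [ ι 0ℚ , ι (1ℚ - + 1 / k) ]
  odd 2∤k with parity k
  ... | inj₁ (l , k≡) = contradiction (divides l (trans k≡ (trans (cong (_+_ l) (sym (+-identityʳ l))) (*-comm 2 l)))) 2∤k
  ... | inj₂ (l , k≡) rewrite 1-1/n≡[n-1]/n k {{_}} =
    (λ (≤z , z≤) → (λ q → ≤z (0≤liminf q)) , λ q → limsup≤ (z≤ q)) ,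
    (λ (≤z , z≤) → (λ q → ≤z (liminf≤0 q)) , λ q → ≤limsup-odd l k≡ (z≤ q))
  even : 2 ∣ k →
    [ ι 0ℚ , ι (_/_ (+ (k ^ 2) ℤ.- + k ℤ.- + 1) (k ^ 2) {{m^n≢0 k 2}}) ]
      ⊆ relativeInterval G (FWF G k) (FIFO G k)
    × relativeInterval G (FWF G k) (FIFO G k) ⊆ [ ι 0ℚ , ι ((+ k ℤ.- + 1) / k) ]
  -- Since `k` is positive, half of it is a successor.
  even (divides (suc l) k≡) =
    (λ (≤z , z≤) → (λ q → ≤z (liminf≤0 q)) ,
                   λ q → ≤limsup-even l (trans k≡ (trans (*-comm (suc l) 2) (cong (_+_ (suc l)) (+-identityʳ (suc l))))) (z≤ q)) ,
    (λ (≤z , z≤) → (λ q → ≤z (0≤liminf q)) , λ q → limsup≤ (z≤ q))
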